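{- Let $\mathbb A$ be a combinatorial atlas of dimension $d$ that satisfies the inheritance property (Inh) and the pullback property (Pull), and let $v\in\Omega^+$ be a non-sink regular vertex of its digraph $\Gamma$. Suppose every out-neighbor of $v$ is hyperbolic. Then $v$ is also hyperbolic.
   Context: **Combinatorial atlas.** Let $\mathcal P=(\Omega,\prec)$ be a locally finite poset of bounded height and let $\Gamma=(\Omega,\Theta)$ be the acyclic digraph given by its Hasse diagram. Let $\Omega^0$ be the set of maximal elements of $\mathcal P$ (sinks of $\Gamma$) and $\Omega^+=\Omega\setminus\Omega^0$ the non-sink vertices. A combinatorial atlas $\mathbb A$ of dimension $d$ is $\Gamma$ with the following structure: each $v\in\Omega$ is associated with a pair $(M_v,h_v)$, where $M_v$ is a nonnegative symmetric $d\times d$ real matrix and $h_v\in\mathbb R_{\ge0}^d$; each $v\in\Omega^+$ has outdegree $d$, with outgoing edges labeled by $i\in[d]=\{1,\dots,d\}$, the edge labeled $i$ being $(v,v^{\langle i\rangle})$; and each such edge is associated with a linear map $T_v^{\langle i\rangle}:\mathbb R^d\to\mathbb R^d$. For fixed $v\in\Omega^+$ write $M=M_v$, $h=h_v=(h_1,\dots,h_d)$, $T^{\langle i\rangle}=T_v^{\langle i\rangle}$, $M^{\langle i\rangle}=M_{v^{\langle i\rangle}}$. The support of a symmetric matrix is $\mathrm{supp}(M)=\{i\in[d]:M_{ij}\ne0\text{ for some }j\}$. $\langle\cdot,\cdot\rangle$ is the standard inner product on $\mathbb R^d$. **Hyperbolic.** A vertex $v\in\Omega$ is hyperbolic if $M=M_v$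 satisfies $\langle x,My\rangle^2\ge\langle x,Mx\rangle\langle y,My\rangle$ for all $x,y\in\mathbb R^d$ with $\langle y,My\rangle>0$. **(Inh)** For every $v\in\Omega^+$: $(Mx)_i=\langle T^{\langle i\rangle}x,\ M^{\langle i\rangle}T^{\langle i\rangle}h\rangle$ for every $i\in\mathrm{supp}(M)$ and $x\in\mathbb R^d$. **(Pull)** For every $v\in\Omega^+$: $\sum_{i\in\mathrm{supp}(M)}h_i\,\langle T^{\langle i\rangle}x,\ M^{\langle i\rangle}T^{\langle i\rangle}x\rangle\ \ge\ \langle x,Mx\rangle$ for every $x\in\mathbb R^d$. **Regular.** A vertex $v\in\Omega^+$ is regular if $M_v$ restricted to its support is an irreducible matrix (not similar via a permutation to a block upper triangular matrix with more than one block of positive size), and $h_v$ restricted to $\mathrm{supp}(M_v)$ is strictly positive. -}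

module Defs where

open import Level using (Level; suc; _⊔_)
open import Data.Fin.Base as Fin using (Fin)
open import Data.Fin.Permutation using (Permutation′; _⟨$⟩ʳ_)
open import Data.List.Base using (List; length)
open import Data.List.Membership.Propositional using (_∈_)
open import Data.List.Relation.Unary.Linked using (Linked)
open import Data.Nat.Base as ℕ using (ℕ)
import Data.Nat.Properties as ℕ
open import Data.Product.Base using (Σ-syntax; ∃-syntax; _×_; _,_)
open import Data.Rational.Base as ℚ using (ℚ; 0ℚ; 1ℚ; ½; Positive; NonNegative)
import Data.Rational.Properties as ℚ
open import Data.Vec.Functional using (Vector; foldr)
open import Function.Base using (_∘_)
open import Function.Bundles using (_⇔_)
open import Function.Definitions using (Injective; Surjective)
open import Relation.Binary.Core using (Rel)
open import Relation.Binary.Construct.Closure.Reflexive using (ReflClosure)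
open import Relation.Binary.Structures using (IsStrictPartialOrder)
open import Relation.Binary.PropositionalEquality.Core using (_≡_; cong; cong₂; sym)
open import Relation.Nullary.Decidable.Core using (dec⇒maybe)
open import Relation.Nullary.Negation.Core using (¬_)
open import Tactic.RingSolver using (solve-∀)
open import Tactic.RingSolver.Core.AlmostCommutativeRing using (AlmostCommutativeRing; fromCommutativeRing)

------------------------------------------------------------------------
-- Real numbers: Cauchy sequences of rationals, with the setoid equality
-- "the difference tends to 0" playing the role of the quotient.

IsCauchy : (ℕ → ℚ) → Set
IsCauchy x = ∀ ε → .{{Positive ε}} →
  ∃[ N ] ∀ m n → N ℕ.≤ m → N ℕ.≤ n → ℚ.∣ x m ℚ.- x n ∣ ℚ.≤ ε

record ℝ : Set where
  constructor mkℝ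
  field
    seq    : ℕ → ℚ
    cauchy : IsCauchy seq

open ℝ public

infix 4 _≈_ _≉_ _≤_ _<_

_≈_ : Rel ℝ Level.zero
x ≈ y = ∀ ε → .{{Positive ε}} →
  ∃[ N ] ∀ n → N ℕ.≤ n → ℚ.∣ seq x n ℚ.- seq y n ∣ ℚ.≤ ε

_≉_ : Rel ℝ Level.zero
x ≉ y = ¬ (x ≈ y)

_≤_ : Rel ℝ Level.zero
x ≤ y = ∀ ε → .{{Positive ε}} →
  ∃[ N ] ∀ n → N ℕ.≤ n → seq x n ℚ.≤ seq y n ℚ.+ ε

_<_ : Rel ℝ Level.zero
x < y = ∃[ ε ] Positive ε × (∃[ N ] ∀ n → N ℕ.≤ n → seq x n ℚ.+ ε ℚ.≤ seq y n)

ℚ-ring : AlmostCommutativeRing Level.zero Level.zero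
ℚ-ring = fromCommutativeRing ℚ.+-*-commutativeRing (λ q → dec⇒maybe (0ℚ ℚ.≟ q))

abstract
  open ℚ.≤-Reasoning

  const-cauchy : ∀ q → IsCauchy (λ _ → q)
  const-cauchy q ε = 0 , λ _ _ _ _ → begin
    ℚ.∣ q ℚ.- q ∣ ≡⟨ cong ℚ.∣_∣ (ℚ.+-inverseʳ q) ⟩
    0ℚ            ≤⟨ ℚ.<⇒≤ (ℚ.positive⁻¹ ε) ⟩
    ε             ∎

  +-cauchy : ∀ {x y} → IsCauchy x → IsCauchy y → IsCauchy (λ n → x n ℚ.+ y n)
  +-cauchy {x} {y} cx cy ε =
    let instance δ-pos : Positive (½ ℚ.* ε)
                 δ-pos = ℚ.pos*pos⇒pos ½ ε
        (M , p) = cx (½ ℚ.* ε)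
        (N , q) = cy (½ ℚ.* ε)
    in M ℕ.⊔ N , λ m n M⊔N≤m M⊔N≤n → begin
      ℚ.∣ (x m ℚ.+ y m) ℚ.- (x n ℚ.+ y n) ∣
        ≡⟨ cong ℚ.∣_∣ (regroup (x m) (y m) (x n) (y n)) ⟩
      ℚ.∣ (x m ℚ.- x n) ℚ.+ (y m ℚ.- y n) ∣
        ≤⟨ ℚ.∣p+q∣≤∣p∣+∣q∣ (x m ℚ.- x n) (y m ℚ.- y n) ⟩
      ℚ.∣ x m ℚ.- x n ∣ ℚ.+ ℚ.∣ y m ℚ.- y n ∣
        ≤⟨ ℚ.+-mono-≤ (p m n (ℕ.m⊔n≤o⇒m≤o M N M⊔N≤m) (ℕ.m⊔n≤o⇒m≤o M N M⊔N≤n))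
                      (q m n (ℕ.m⊔n≤o⇒n≤o M N M⊔N≤m) (ℕ.m⊔n≤o⇒n≤o M N M⊔N≤n)) ⟩
      ½ ℚ.* ε ℚ.+ ½ ℚ.* ε
        ≡⟨ sym (ℚ.*-distribʳ-+ ε ½ ½) ⟩
      1ℚ ℚ.* ε
        ≡⟨ ℚ.*-identityˡ ε ⟩
      ε ∎
    where
    regroup : ∀ a b c d → (a ℚ.+ b) ℚ.- (c ℚ.+ d) ≡ (a ℚ.- c) ℚ.+ (b ℚ.- d)
    regroup = solve-∀ ℚ-ring

  cauchy⇒eventually-bounded : ∀ {x} → IsCauchy x →
    ∃[ B ] Positive B × (∃[ N ] ∀ n → N ℕ.≤ n → ℚ.∣ x n ∣ ℚ.≤ B)
  cauchy⇒eventually-bounded {x} cx =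
    let (N , p) = cx 1ℚ
        instance ∣xN∣-nonNeg : NonNegative ℚ.∣ x N ∣
                 ∣xN∣-nonNeg = ℚ.∣-∣-nonNeg (x N)
    in 1ℚ ℚ.+ ℚ.∣ x N ∣ , ℚ.pos+nonNeg⇒pos 1ℚ ℚ.∣ x N ∣ , N , λ n N≤n → begin
      ℚ.∣ x n ∣                           ≡⟨ cong ℚ.∣_∣ (split (x n) (x N)) ⟩
      ℚ.∣ (x n ℚ.- x N) ℚ.+ x N ∣         ≤⟨ ℚ.∣p+q∣≤∣p∣+∣q∣ (x n ℚ.- x N) (x N) ⟩
      ℚ.∣ x n ℚ.- x N ∣ ℚ.+ ℚ.∣ x N ∣     ≤⟨ ℚ.+-monoˡ-≤ ℚ.∣ x N ∣ (p n N N≤n ℕ.≤-refl) ⟩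
      1ℚ ℚ.+ ℚ.∣ x N ∣                    ∎
    where
    split : ∀ a b → a ≡ (a ℚ.- b) ℚ.+ b
    split = solve-∀ ℚ-ring

  *-mono-≤ : ∀ {p q r s} → 0ℚ ℚ.≤ r → 0ℚ ℚ.≤ q → p ℚ.≤ q → r ℚ.≤ s → p ℚ.* r ℚ.≤ q ℚ.* s
  *-mono-≤ {q = q} {r = r} 0≤r 0≤q p≤q r≤s = ℚ.≤-trans
    (ℚ.*-monoʳ-≤-nonNeg r {{ℚ.nonNegative 0≤r}} p≤q)
    (ℚ.*-monoˡ-≤-nonNeg q {{ℚ.nonNegative 0≤q}} r≤s)

  ∣ab-cd∣≤ : ∀ {a b c d B C δ} → 0ℚ ℚ.≤ B → 0ℚ ℚ.≤ δ →
    ℚ.∣ a ∣ ℚ.≤ B → ℚ.∣ d ∣ ℚ.≤ C → ℚ.∣ a ℚ.- c ∣ ℚ.≤ δ → ℚ.∣ b ℚ.- d ∣ ℚ.≤ δ →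
    ℚ.∣ a ℚ.* b ℚ.- c ℚ.* d ∣ ℚ.≤ δ ℚ.* (B ℚ.+ C)
  ∣ab-cd∣≤ {a} {b} {c} {d} {B} {C} {δ} 0≤B 0≤δ ∣a∣≤B ∣d∣≤C ∣a-c∣≤δ ∣b-d∣≤δ = begin
    ℚ.∣ a ℚ.* b ℚ.- c ℚ.* d ∣
      ≡⟨ cong ℚ.∣_∣ (regroup a b c d) ⟩
    ℚ.∣ a ℚ.* (b ℚ.- d) ℚ.+ (a ℚ.- c) ℚ.* d ∣
      ≤⟨ ℚ.∣p+q∣≤∣p∣+∣q∣ (a ℚ.* (b ℚ.- d)) ((a ℚ.- c) ℚ.* d) ⟩
    ℚ.∣ a ℚ.* (b ℚ.- d) ∣ ℚ.+ ℚ.∣ (a ℚ.- c) ℚ.* d ∣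
      ≡⟨ cong₂ ℚ._+_ (ℚ.∣p*q∣≡∣p∣*∣q∣ a (b ℚ.- d)) (ℚ.∣p*q∣≡∣p∣*∣q∣ (a ℚ.- c) d) ⟩
    ℚ.∣ a ∣ ℚ.* ℚ.∣ b ℚ.- d ∣ ℚ.+ ℚ.∣ a ℚ.- c ∣ ℚ.* ℚ.∣ d ∣
      ≤⟨ ℚ.+-mono-≤ (*-mono-≤ (ℚ.0≤∣p∣ (b ℚ.- d)) 0≤B ∣a∣≤B ∣b-d∣≤δ)
                    (*-mono-≤ (ℚ.0≤∣p∣ d) 0≤δ ∣a-c∣≤δ ∣d∣≤C) ⟩
    B ℚ.* δ ℚ.+ δ ℚ.* C
      ≡⟨ factor B C δ ⟩
    δ ℚ.* (B ℚ.+ C) ∎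
    where
    regroup : ∀ a b c d → a ℚ.* b ℚ.- c ℚ.* d ≡ a ℚ.* (b ℚ.- d) ℚ.+ (a ℚ.- c) ℚ.* d
    regroup = solve-∀ ℚ-ring

    factor : ∀ b c e → b ℚ.* e ℚ.+ e ℚ.* c ≡ e ℚ.* (b ℚ.+ c)
    factor = solve-∀ ℚ-ring

  ∃-divisor : ∀ ε .{{_ : Positive ε}} D .{{_ : Positive D}} → ∃[ δ ] Positive δ × δ ℚ.* D ≡ ε
  ∃-divisor ε D = ε ℚ.* D⁻¹ , ℚ.pos*pos⇒pos ε D⁻¹ {{ℚ.1/pos⇒pos D}} , (begin-equality
    ε ℚ.* D⁻¹ ℚ.* D   ≡⟨ ℚ.*-assoc ε D⁻¹ D ⟩
    ε ℚ.* (D⁻¹ ℚ.* D) ≡⟨ cong (ε ℚ.*_) (ℚ.*-inverseˡ D {{ℚ.pos⇒nonZero D}}) ⟩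
    ε ℚ.* 1ℚ          ≡⟨ ℚ.*-identityʳ ε ⟩
    ε                 ∎)
    where
    D⁻¹ : ℚ
    D⁻¹ = (ℚ.1/ D) {{ℚ.pos⇒nonZero D}}

  *-cauchy : ∀ {x y} → IsCauchy x → IsCauchy y → IsCauchy (λ n → x n ℚ.* y n)
  *-cauchy {x} {y} cx cy ε =
    let (B , B-pos , K , ∣x∣≤B) = cauchy⇒eventually-bounded {x} cx
        (C , C-pos , L , ∣y∣≤C) = cauchy⇒eventually-bounded {y} cy
        (δ , δ-pos , δ[B+C]≡ε) = ∃-divisor ε (B ℚ.+ C) {{ℚ.pos+pos⇒pos B {{B-pos}} C {{C-pos}}}}
        (M , p) = cx δ {{δ-pos}}
        (N , q) = cy δ {{δ-pos}}
    in (K ℕ.⊔ L) ℕ.⊔ (M ℕ.⊔ N) , λ m n ≤m ≤n →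
      let K⊔L≤m = ℕ.m⊔n≤o⇒m≤o (K ℕ.⊔ L) (M ℕ.⊔ N) ≤m
          M⊔N≤m = ℕ.m⊔n≤o⇒n≤o (K ℕ.⊔ L) (M ℕ.⊔ N) ≤m
          K⊔L≤n = ℕ.m⊔n≤o⇒m≤o (K ℕ.⊔ L) (M ℕ.⊔ N) ≤n
          M⊔N≤n = ℕ.m⊔n≤o⇒n≤o (K ℕ.⊔ L) (M ℕ.⊔ N) ≤n
      in ℚ.≤-trans
        (∣ab-cd∣≤ {x m} {y m} {x n} {y n} {B} {C} {δ}
          (ℚ.<⇒≤ (ℚ.positive⁻¹ B {{B-pos}})) (ℚ.<⇒≤ (ℚ.positive⁻¹ δ {{δ-pos}}))
          (∣x∣≤B m (ℕ.m⊔n≤o⇒m≤o K L K⊔L≤m)) (∣y∣≤C n (ℕ.m⊔n≤o⇒n≤o K L K⊔L≤n))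
          (p m n (ℕ.m⊔n≤o⇒m≤o M N M⊔N≤m) (ℕ.m⊔n≤o⇒m≤o M N M⊔N≤n))
          (q m n (ℕ.m⊔n≤o⇒n≤o M N M⊔N≤m) (ℕ.m⊔n≤o⇒n≤o M N M⊔N≤n)))
        (ℚ.≤-reflexive δ[B+C]≡ε)

infixl 6 _+_
infixl 7 _*_

0ℝ : ℝ
0ℝ = mkℝ (λ _ → 0ℚ) (const-cauchy 0ℚ)

_+_ : ℝ → ℝ → ℝ
x + y = mkℝ (λ n → seq x n ℚ.+ seq y n) (+-cauchy {seq x} {seq y} (cauchy x) (cauchy y))

_*_ : ℝ → ℝ → ℝ
x * y = mkℝ (λ n → seq x n ℚ.* seq y n) (*-cauchy {seq x} {seq y} (cauchy x) (cauchy y))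

------------------------------------------------------------------------
-- Linear algebra over ℝ

Matrix : ℕ → Set
Matrix d = Fin d → Fin d → ℝ

∑ : ∀ {d} → Vector ℝ d → ℝ
∑ = foldr _+_ 0ℝ

infix 9 ⟨_,_⟩

⟨_,_⟩ : ∀ {d} → Vector ℝ d → Vector ℝ d → ℝ
⟨ x , y ⟩ = ∑ (λ i → x i * y i)

infixr 8 _·_

_·_ : ∀ {d} → Matrix d → Vector ℝ d → Vector ℝ d
(M · x) i = ∑ (λ j → M i j * x j)

record LinearMap (d : ℕ) : Set where
  field
    apply  : Vector ℝ d → Vector ℝ d
    ≈-cong : ∀ {x y} → (∀ i → x i ≈ y i) → ∀ i → apply x i ≈ apply y i
    +-homo : ∀ x y i → apply (λ j → x j + y j) i ≈ apply x i + apply y i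
    *-homo : ∀ c x i → apply (λ j → c * x j) i ≈ c * apply x i

Supp : ∀ {d} → Matrix d → Fin d → Set
Supp M i = ∃[ j ] M i j ≉ 0ℝ

-- A listing of supp(M) without repetition. Equality of reals is undecidable,
-- so such a listing cannot be computed from M, although ¬¬-constructively
-- (hence classically) one always exists. Notions involving a sum over supp(M)
-- or the restriction of M to supp(M) are stated for an arbitrary listing;
-- they do not depend on the choice.
record SuppEnumeration {d : ℕ} (M : Matrix d) : Set where
  field
    size      : ℕ
    index     : Fin size → Fin d
    injective : Injective _≡_ _≡_ index
    range     : ∀ i → Supp M i ⇔ (∃[ k ] index k ≡ i)

∑-supp : ∀ {d} {M : Matrix d} → SuppEnumeration M → Vector ℝ d → ℝ
∑-supp E f = ∑ (f ∘ SuppEnumeration.index E)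

restrict : ∀ {d} {M : Matrix d} (E : SuppEnumeration M) → Matrix (SuppEnumeration.size E)
restrict {M = M} E k l = M (index k) (index l)
  where open SuppEnumeration E

PermutationSimilar : ∀ {n} → Matrix n → Matrix n → Set
PermutationSimilar {n} A B =
  Σ[ π ∈ Permutation′ n ] ∀ i j → B i j ≈ A (π ⟨$⟩ʳ i) (π ⟨$⟩ʳ j)

-- Consecutive indices are grouped into r blocks, index i lying in block
-- number (block i); surjectivity says that every block has positive size.
record BlockUpperTriangular {n : ℕ} (r : ℕ) (A : Matrix n) : Set where
  field
    block      : Fin n → Fin r
    monotone   : ∀ {i j} → i Fin.≤ j → block i Fin.≤ block j
    surjective : Surjective _≡_ _≡_ block
    zeros      : ∀ i j → block j Fin.< block i → A i j ≈ 0ℝ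

Irreducible : ∀ {n} → Matrix n → Set
Irreducible {n} A =
  ¬ (Σ[ B ∈ Matrix n ] ∃[ r ] 1 ℕ.< r × PermutationSimilar A B × BlockUpperTriangular r B)

HyperbolicMatrix : ∀ {d} → Matrix d → Set
HyperbolicMatrix M = ∀ x y → 0ℝ < ⟨ y , M · y ⟩ →
  ⟨ x , M · x ⟩ * ⟨ y , M · y ⟩ ≤ ⟨ x , M · y ⟩ * ⟨ x , M · y ⟩

------------------------------------------------------------------------
-- Posets and their Hasse diagrams

module _ {a ℓ : Level} {Ω : Set a} (_≺_ : Rel Ω ℓ) where

  LocallyFinite : Set (a ⊔ ℓ)
  LocallyFinite = ∀ x y → Σ[ zs ∈ List Ω ] (∀ z → x ≼ z → z ≼ y → z ∈ zs)
    where _≼_ = ReflClosure _≺_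

  BoundedHeight : Set (a ⊔ ℓ)
  BoundedHeight = ∃[ H ] (∀ chain → Linked _≺_ chain → length chain ℕ.≤ H)

  Covers : Rel Ω (a ⊔ ℓ)
  Covers x y = x ≺ y × ¬ (Σ[ z ∈ Ω ] x ≺ z × z ≺ y)

  IsMaximal : Ω → Set (a ⊔ ℓ)
  IsMaximal x = ∀ y → ¬ (x ≺ y)

  record NonMaximal : Set (a ⊔ ℓ) where
    constructor nonMaximal
    field
      vertex      : Ω
      .notMaximal : ¬ IsMaximal vertex

------------------------------------------------------------------------
-- Combinatorial atlases

record Atlas (a ℓ : Level) (d : ℕ) : Set (suc (a ⊔ ℓ)) where
  infix 4 _≺_ _⟶_
  field
    Ω                    : Set a
    _≺_                  : Rel Ω ℓ
    isStrictPartialOrder : IsStrictPartialOrder _≡_ _≺_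
    locallyFinite        : LocallyFinite _≺_
    boundedHeight        : BoundedHeight _≺_

  _⟶_ : Rel Ω (a ⊔ ℓ)
  _⟶_ = Covers _≺_

  Ω⁺ : Set (a ⊔ ℓ)
  Ω⁺ = NonMaximal _≺_

  open NonMaximal public

  field
    M           : Ω → Matrix d
    M-symmetric : ∀ v i j → M v i j ≈ M v j i
    M-nonNeg    : ∀ v i j → 0ℝ ≤ M v i j
    h           : Ω → Vector ℝ d
    h-nonNeg    : ∀ v i → 0ℝ ≤ h v i

    -- i ↦ next v i is a bijection from the labels onto the out-neighbours of v
    next            : Ω⁺ → Fin d → Ω
    next-edge       : ∀ v i → vertex v ⟶ next v i
    next-injective  : ∀ v → Injective _≡_ _≡_ (next v)
    next-surjective : ∀ v w → vertex v ⟶ w → ∃[ i ] next v i ≡ w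

    linearMap : Ω⁺ → Fin d → LinearMap d

  T : Ω⁺ → Fin d → Vector ℝ d → Vector ℝ d
  T v i = LinearMap.apply (linearMap v i)

  Hyperbolic : Ω → Set
  Hyperbolic v = HyperbolicMatrix (M v)

  Inh : Set (a ⊔ ℓ)
  Inh = ∀ (v : Ω⁺) i → Supp (M (vertex v)) i → ∀ x →
    (M (vertex v) · x) i ≈ ⟨ T v i x , M (next v i) · T v i (h (vertex v)) ⟩

  Pull : Set (a ⊔ ℓ)
  Pull = ∀ (v : Ω⁺) (E : SuppEnumeration (M (vertex v))) x →
    ⟨ x , M (vertex v) · x ⟩ ≤
    ∑-supp E (λ i → h (vertex v) i * ⟨ T v i x , M (next v i) · T v i x ⟩)

  Regular : Ω⁺ → Set
  Regular v =
    (∀ (E : SuppEnumeration (M (vertex v))) → Irreducible (restrict E)) ×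
    (∀ i → Supp (M (vertex v)) i → 0ℝ < h (vertex v) i)

{-# OPTIONS --safe #-}
module Submission where

-- Restrict to the support and put C i j = h i * M i j * h j. Its row sums
-- deg i = h i * (M h) i are positive, and C is the weight matrix of a connected
-- graph with Laplacian L = deg − C, which is positive semidefinite with kernel
-- the constants. Hyperbolicity of the out-neighbours combined with (Inh) and
-- (Pull) gives ⟨u,Cu⟩ ≤ ∑ (Cu)ᵢ² / degᵢ, equivalently ⟨u,Lu⟩ ≤ ∑ (Lu)ᵢ² / degᵢ.
-- If deg y has sum zero, then L w = deg y is solvable, and
-- 0 ≤ ⟨y−w,L(y−w)⟩ ≤ ⟨y,Ly⟩ − ⟨y,deg y⟩ = −⟨y,Cy⟩. So M is negative
-- semidefinite on the M-orthogonal complement of h, which is hyperbolicity.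
-- This replaces the spectral theorem and Perron–Frobenius by finitely many
-- case distinctions, available constructively because _≤_ on ℝ is ¬¬-stable.

open import Defs using (ℝ; mkℝ; seq; cauchy; IsCauchy; ℚ-ring; const-cauchy; cauchy⇒eventually-bounded; ∣ab-cd∣≤; ∃-divisor; Supp; SuppEnumeration; restrict; Irreducible; Atlas)
open import Level using (Level; 0ℓ)
open import Algebra.Bundles using (CommutativeRing)
import Algebra.Properties.Semiring.Sum
import Algebra.Solver.Ring
open import Algebra.Solver.Ring.AlmostCommutativeRing using (fromCommutativeRing; Induced-equivalence; _-Raw-AlmostCommutative⟶_)
open import Algebra.Structures using (IsCommutativeRing)
open import Data.Bool.Base using (Bool; true; false; not; if_then_else_)
open import Data.Fin.Base as Fin using (Fin; zero; suc; fromℕ; punchOut)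
open import Data.Fin.Permutation as Perm using (Permutation′; _⟨$⟩ʳ_; _⟨$⟩ˡ_; lift₀; insert)
import Data.Fin.Properties as Fin
open import Data.List.Base using (List; _∷_; length; lookup; filter; allFin)
open import Data.List.Membership.Propositional.Properties using (∈-lookup; ∈-filter⁺; ∈-filter⁻; ∈-allFin)
import Data.List.Relation.Unary.All as All
open import Data.List.Relation.Unary.AllPairs using (_∷_)
open import Data.List.Relation.Unary.Any using (index)
open import Data.List.Relation.Unary.Any.Properties using (lookup-index)
open import Data.List.Relation.Unary.Unique.Propositional using (Unique)
open import Data.List.Relation.Unary.Unique.Propositional.Properties using (filter⁺; allFin⁺)
import Data.Maybe.Base as Maybe
open import Data.Nat.Base as ℕ using (ℕ; zero; suc; z≤n; s≤s)
import Data.Nat.Properties as ℕ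
open import Data.Product.Base using (∃-syntax; Σ-syntax; _×_; _,_; proj₁; proj₂; curry)
open import Data.Rational.Base as ℚ using (ℚ; 0ℚ; 1ℚ; ½; Positive)
import Data.Rational.Properties as ℚ
open import Data.Sum.Base using (_⊎_; inj₁; inj₂; [_,_]′)
open import Data.Vec.Functional as Vector using (Vector)
open import Effect.Monad using (RawMonad)
open import Function.Base using (_∘_)
open import Function.Bundles using (mk⇔; Equivalence)
open import Function.Definitions using (Injective)
open import Relation.Binary.Bundles using (Poset)
open import Relation.Binary.Core using (Rel)
open import Relation.Binary.Definitions using (WeaklyDecidable)
open import Relation.Binary.PropositionalEquality.Core as ≡ using (_≡_; _≢_; cong; cong₂; subst)
open import Relation.Binary.Structures using (IsPartialOrder)
open import Relation.Nullary.Decidable using (dec-true; dec-false)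
open import Relation.Nullary.Decidable.Core using (Dec; does; yes; no; dec⇒maybe; ¬¬-excluded-middle)
open import Relation.Nullary.Negation using (¬¬-Monad)
open import Relation.Nullary.Negation.Core using (¬_; contradiction; ¬¬-map)
open import Tactic.RingSolver using (solve-∀)

-- Linear algebra over an ordered field

-- The spectral picture behind the argument: let `D` be the diagonal matrix of `deg`. Then `D⁻¹C` is
-- self-adjoint for the inner product weighted by `deg`, and it fixes the constant vectors. On an
-- eigenvector with eigenvalue λ the bound on ⟨u,Cu⟩ reads λ ≤ λ², so no eigenvalue lies strictly
-- between 0 and 1. The row sums force λ ≤ 1 and connectedness makes 1 simple, so every other
-- eigenvalue is at most 0. Passing from `C` to `L` replaces λ by 1 - λ, which preserves λ² - λ;
-- hence the two bounds are one inequality. The obstacle is that eigenvectors are not at hand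
-- constructively. Solving one linear system by orthogonal projection is enough, because the bound
-- at the solution `w` can be compared with the form at `y` through positivity of `L` alone.

¬¬-sequence : ∀ {p n} {P : Fin n → Set p} → (∀ i → ¬ ¬ P i) → ¬ ¬ (∀ i → P i)
¬¬-sequence = Fin.sequence (RawMonad.rawApplicative ¬¬-Monad)

-- Ordered fields with a stable order

record OrderedField : Set₁ where
  infix 4 _≤_ _<_
  field
    commutativeRing : CommutativeRing 0ℓ 0ℓ
  open CommutativeRing commutativeRing public
    hiding (_≉_; zero; isPartialEquivalence)
  field
    -- Supplies the ring solver with coefficients whose equality is decidable.
    fromℚ          : ℚ.+-*-rawRing -Raw-AlmostCommutative⟶ fromCommutativeRing commutativeRing
    _≤_ _<_        : Rel Carrier 0ℓ
    isPartialOrder : IsPartialOrder _≈_ _≤_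
    +-monoˡ-≤      : ∀ {x y} z → x ≤ y → x + z ≤ y + z
    <⇒≤            : ∀ {x y} → x < y → x ≤ y
    <⇒≱            : ∀ {x y} → x < y → ¬ (y ≤ x)
    -- Stands in for totality of the order, which the reals do not have constructively. Since
    -- `x < y` refutes `y ≤ x`, it makes `_≤_` stable under double negation.
    ≮⇒≥            : ∀ {x y} → ¬ (x < y) → y ≤ x
    <-≤-trans      : ∀ {x y z} → x < y → y ≤ z → x < z
    *-pos          : ∀ {x y} → 0# < x → 0# < y → 0# < x * y
    inverse        : ∀ {x} → 0# < x → ∃[ y ] 0# ≤ y × x * y ≈ 1#

  poset : Poset 0ℓ 0ℓ 0ℓ
  poset = record { isPartialOrder = isPartialOrder }

module OrderedFieldProperties (F : OrderedField) where
  open OrderedField F public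
  open IsPartialOrder isPartialOrder public using (antisym; ≤-respʳ-≈; ≤-respˡ-≈)
    renaming (reflexive to ≤-reflexive; trans to ≤-trans; refl to ≤-refl)
  open import Relation.Binary.Reasoning.PartialOrder poset
  open _-Raw-AlmostCommutative⟶_ fromℚ public using (⟦_⟧)

  coefficient≟ : WeaklyDecidable (Induced-equivalence fromℚ)
  coefficient≟ p q = Maybe.map (λ p≡q → reflexive (≡.cong ⟦_⟧ p≡q)) (dec⇒maybe (p ℚ.≟ q))

  module Solver = Algebra.Solver.Ring ℚ.+-*-rawRing (fromCommutativeRing commutativeRing) fromℚ coefficient≟
  open Solver hiding (⟦_⟧)

  ≤-stable : ∀ {x y} → ¬ ¬ (x ≤ y) → x ≤ y
  ≤-stable ¬¬x≤y = ≮⇒≥ λ y<x → ¬¬x≤y (<⇒≱ y<x)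

  ≈-stable : ∀ {x y} → ¬ ¬ (x ≈ y) → x ≈ y
  ≈-stable ¬¬x≈y = antisym
    (≤-stable λ x≰y → ¬¬x≈y (x≰y ∘ ≤-reflexive))
    (≤-stable λ y≰x → ¬¬x≈y (y≰x ∘ ≤-reflexive ∘ sym))

  +-mono-≤ : ∀ {w x y z} → w ≤ x → y ≤ z → w + y ≤ x + z
  +-mono-≤ {w} {x} {y} {z} w≤x y≤z = begin
    w + y ≤⟨ +-monoˡ-≤ y w≤x ⟩
    x + y ≈⟨ +-comm x y ⟩
    y + x ≤⟨ +-monoˡ-≤ x y≤z ⟩
    z + x ≈⟨ +-comm z x ⟩
    x + z ∎

  x≤y⇒0≤y-x : ∀ {x y} → x ≤ y → 0# ≤ y - x
  x≤y⇒0≤y-x {x} {y} x≤y = begin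
    0#    ≈⟨ -‿inverseʳ x ⟨
    x - x ≤⟨ +-monoˡ-≤ (- x) x≤y ⟩
    y - x ∎

  0≤y-x⇒x≤y : ∀ {x y} → 0# ≤ y - x → x ≤ y
  0≤y-x⇒x≤y {x} {y} 0≤y-x = begin
    x         ≈⟨ +-identityˡ x ⟨
    0# + x    ≤⟨ +-monoˡ-≤ x 0≤y-x ⟩
    y - x + x ≈⟨ solve 2 (λ x y → y :- x :+ x := y) refl x y ⟩
    y         ∎

  +-nonNeg : ∀ {x y} → 0# ≤ x → 0# ≤ y → 0# ≤ x + y
  +-nonNeg 0≤x 0≤y = ≤-respˡ-≈ (+-identityˡ 0#) (+-mono-≤ 0≤x 0≤y)

  -- The sign of a real is available only under double negation; this suffices whenever the goal is
  -- a stable relation such as `_≤_` or `_≈_`.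
  0<x⊎x≤0 : ∀ x → ¬ ¬ (0# < x ⊎ x ≤ 0#)
  0<x⊎x≤0 x k = k (inj₂ (≮⇒≥ (k ∘ inj₁)))

  *-nonNeg : ∀ {x y} → 0# ≤ x → 0# ≤ y → 0# ≤ x * y
  *-nonNeg {x} {y} 0≤x 0≤y = ≤-stable λ ¬0≤xy →
    0<x⊎x≤0 x λ where
      (inj₂ x≤0) → ¬0≤xy (≤-reflexive (sym (trans (*-congʳ (antisym x≤0 0≤x)) (zeroˡ y))))
      (inj₁ 0<x) → 0<x⊎x≤0 y λ where
        (inj₂ y≤0) → ¬0≤xy (≤-reflexive (sym (trans (*-congˡ (antisym y≤0 0≤y)) (zeroʳ x))))
        (inj₁ 0<y) → ¬0≤xy (<⇒≤ (*-pos 0<x 0<y))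

  *-monoˡ-≤ : ∀ {x y z} → 0# ≤ z → x ≤ y → z * x ≤ z * y
  *-monoˡ-≤ {x} {y} {z} 0≤z x≤y = 0≤y-x⇒x≤y (begin
    0#            ≤⟨ *-nonNeg 0≤z (x≤y⇒0≤y-x x≤y) ⟩
    z * (y - x)   ≈⟨ solve 3 (λ x y z → z :* (y :- x) := z :* y :- z :* x) refl x y z ⟩
    z * y - z * x ∎)

  x≤0⇒0≤-x : ∀ {x} → x ≤ 0# → 0# ≤ - x
  x≤0⇒0≤-x x≤0 = ≤-respʳ-≈ (+-identityˡ _) (x≤y⇒0≤y-x x≤0)

  0≤x*x : ∀ x → 0# ≤ x * x
  0≤x*x x = ≤-stable λ k → 0<x⊎x≤0 x λ where
    (inj₁ 0<x) → k (<⇒≤ (*-pos 0<x 0<x))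
    (inj₂ x≤0) → k (begin
      0#            ≤⟨ *-nonNeg (x≤0⇒0≤-x x≤0) (x≤0⇒0≤-x x≤0) ⟩
      - x * - x     ≈⟨ solve 1 (λ x → :- x :* :- x := x :* x) refl x ⟩
      x * x         ∎)

  *-cancelˡ-≤ : ∀ {x y z} → 0# < z → z * x ≤ z * y → x ≤ y
  *-cancelˡ-≤ {x} {y} {z} 0<z zx≤zy with inverse 0<z
  ... | i , 0≤i , zi≈1 = begin
    x           ≈⟨ cancel x ⟨
    i * (z * x) ≤⟨ *-monoˡ-≤ 0≤i zx≤zy ⟩
    i * (z * y) ≈⟨ cancel y ⟩
    y           ∎
    where
    cancel : ∀ t → i * (z * t) ≈ t
    cancel t = begin-equality
      i * (z * t) ≈⟨ solve 3 (λ i z t → i :* (z :* t) := z :* i :* t) refl i z t ⟩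
      z * i * t   ≈⟨ *-congʳ zi≈1 ⟩
      1# * t      ≈⟨ *-identityˡ t ⟩
      t           ∎

  *-cancelˡ-≈0 : ∀ {x y} → 0# < x → x * y ≈ 0# → y ≈ 0#
  *-cancelˡ-≈0 {x} {y} 0<x xy≈0 = antisym
    (*-cancelˡ-≤ 0<x (≤-reflexive (trans xy≈0 (sym (zeroʳ x)))))
    (*-cancelˡ-≤ 0<x (≤-reflexive (trans (zeroʳ x) (sym xy≈0))))

  x*x≤0⇒x≈0 : ∀ {x} → x * x ≤ 0# → x ≈ 0#
  x*x≤0⇒x≈0 {x} xx≤0 = ≈-stable λ x≉0 → 0<x⊎x≤0 x λ where
    (inj₁ 0<x) → <⇒≱ (*-pos 0<x 0<x) xx≤0
    (inj₂ x≤0) → 0<x⊎x≤0 (- x) λ where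
      (inj₁ 0<-x) → <⇒≱ (*-pos 0<-x 0<-x)
        (≤-respˡ-≈ (solve 1 (λ x → x :* x := :- x :* :- x) refl x) xx≤0)
      (inj₂ -x≤0) → x≉0 (antisym x≤0
        (≤-respʳ-≈ (solve 1 (λ x → :- (:- x) := x) refl x) (x≤0⇒0≤-x -x≤0)))

  -- Avoids halving: for negative `x` the sum `x + x` is at most `x`, so `0# ≤ x + x` would already
  -- give `0# ≤ x`.
  0≤x+x⇒0≤x : ∀ {x} → 0# ≤ x + x → 0# ≤ x
  0≤x+x⇒0≤x {x} 0≤x+x = ≮⇒≥ λ x<0 → <⇒≱ x<0 (begin
    0#     ≤⟨ 0≤x+x ⟩
    x + x  ≤⟨ +-monoˡ-≤ x (<⇒≤ x<0) ⟩
    0# + x ≈⟨ +-identityˡ x ⟩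
    x      ∎)

-- Finite sums, bilinear forms and hyperbolic matrices

module LinearAlgebra (F : OrderedField) where
  open OrderedFieldProperties F
  open Solver hiding (⟦_⟧)
  open Algebra.Properties.Semiring.Sum semiring public
    using (sum; sum-cong-≋; sum-replicate-zero; ∑-distrib-+; ∑-comm; *-distribˡ-sum; *-distribʳ-sum)
  open import Relation.Binary.Reasoning.PartialOrder poset

  private variable
    m n : ℕ

  sum-zero : {f : Vector Carrier n} → (∀ i → f i ≈ 0#) → sum f ≈ 0#
  sum-zero {n} f≈0 = trans (sum-cong-≋ f≈0) (sum-replicate-zero n)

  sum-mono-≤ : {f g : Vector Carrier n} → (∀ i → f i ≤ g i) → sum f ≤ sum g
  sum-mono-≤ {zero}  f≤g = ≤-refl
  sum-mono-≤ {suc n} f≤g = +-mono-≤ (f≤g zero) (sum-mono-≤ (f≤g ∘ suc))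

  sum-nonNeg : {f : Vector Carrier n} → (∀ i → 0# ≤ f i) → 0# ≤ sum f
  sum-nonNeg {zero}  0≤f = ≤-refl
  sum-nonNeg {suc n} 0≤f = +-nonNeg (0≤f zero) (sum-nonNeg (0≤f ∘ suc))

  term≤sum : (f : Vector Carrier n) → (∀ i → 0# ≤ f i) → ∀ i → f i ≤ sum f
  term≤sum f 0≤f zero = ≤-respˡ-≈ (+-identityʳ _) (+-mono-≤ ≤-refl (sum-nonNeg (0≤f ∘ suc)))
  term≤sum f 0≤f (suc i) = ≤-respˡ-≈ (+-identityˡ _) (+-mono-≤ (0≤f zero) (term≤sum (f ∘ suc) (0≤f ∘ suc) i))

  sum-linear : ∀ a b (f g : Vector Carrier n) →
    sum (λ i → a * f i + b * g i) ≈ a * sum f + b * sum g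
  sum-linear a b f g = begin-equality
    sum (λ i → a * f i + b * g i)             ≈⟨ ∑-distrib-+ (λ i → a * f i) (λ i → b * g i) ⟩
    sum (λ i → a * f i) + sum (λ i → b * g i) ≈⟨ +-cong (*-distribˡ-sum a f) (*-distribˡ-sum b g) ⟨
    a * sum f + b * sum g                     ∎

  Matrix : ℕ → Set
  Matrix n = Fin n → Fin n → Carrier

  infix 9 ⟨_,_⟩
  infixr 8 _·_

  ⟨_,_⟩ : Vector Carrier n → Vector Carrier n → Carrier
  ⟨ x , y ⟩ = sum (λ i → x i * y i)

  _·_ : Matrix n → Vector Carrier n → Vector Carrier n
  (M · x) i = sum (λ j → M i j * x j)

  ⟨⟩-cong : {w x y z : Vector Carrier n} → (∀ i → w i ≈ x i) → (∀ i → y i ≈ z i) → ⟨ w , y ⟩ ≈ ⟨ x , z ⟩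
  ⟨⟩-cong w≈x y≈z = sum-cong-≋ λ i → *-cong (w≈x i) (y≈z i)

  ⟨⟩-comm : (x y : Vector Carrier n) → ⟨ x , y ⟩ ≈ ⟨ y , x ⟩
  ⟨⟩-comm x y = sum-cong-≋ λ i → *-comm (x i) (y i)

  ⟨⟩-linearˡ : ∀ a b (x y z : Vector Carrier n) →
    ⟨ (λ i → a * x i + b * y i) , z ⟩ ≈ a * ⟨ x , z ⟩ + b * ⟨ y , z ⟩
  ⟨⟩-linearˡ a b x y z = trans
    (sum-cong-≋ λ i → solve 5 (λ a b x y z → (a :* x :+ b :* y) :* z := a :* (x :* z) :+ b :* (y :* z))
                        refl a b (x i) (y i) (z i))
    (sum-linear a b (λ i → x i * z i) (λ i → y i * z i))

  ⟨⟩-linearʳ : ∀ a b (x y z : Vector Carrier n) →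
    ⟨ z , (λ i → a * x i + b * y i) ⟩ ≈ a * ⟨ z , x ⟩ + b * ⟨ z , y ⟩
  ⟨⟩-linearʳ a b x y z = trans (⟨⟩-comm z _) (trans (⟨⟩-linearˡ a b x y z)
    (+-cong (*-congˡ (⟨⟩-comm x z)) (*-congˡ (⟨⟩-comm y z))))

  ⟨x,x⟩≤0⇒x≈0 : (x : Vector Carrier n) → ⟨ x , x ⟩ ≤ 0# → ∀ i → x i ≈ 0#
  ⟨x,x⟩≤0⇒x≈0 x ⟨x,x⟩≤0 i =
    x*x≤0⇒x≈0 (≤-trans (term≤sum (λ i → x i * x i) (λ i → 0≤x*x (x i)) i) ⟨x,x⟩≤0)

  Symmetric : Matrix n → Set
  Symmetric M = ∀ i j → M i j ≈ M j i

  form-symmetric : {M : Matrix n} → Symmetric M → ∀ x y → ⟨ x , M · y ⟩ ≈ ⟨ y , M · x ⟩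
  form-symmetric {M = M} M-sym x y = begin-equality
    sum (λ i → x i * sum (λ j → M i j * y j))   ≈⟨ sum-cong-≋ (λ i → *-distribˡ-sum (x i) (λ j → M i j * y j)) ⟩
    sum (λ i → sum (λ j → x i * (M i j * y j))) ≈⟨ ∑-comm (λ i j → x i * (M i j * y j)) ⟩
    sum (λ j → sum (λ i → x i * (M i j * y j))) ≈⟨ sum-cong-≋ (λ j → sum-cong-≋ λ i → swap i j) ⟩
    sum (λ j → sum (λ i → y j * (M j i * x i))) ≈⟨ sum-cong-≋ (λ j → *-distribˡ-sum (y j) (λ i → M j i * x i)) ⟨
    sum (λ j → y j * sum (λ i → M j i * x i))   ∎
    where
    swap : ∀ i j → x i * (M i j * y j) ≈ y j * (M j i * x i)
    swap i j = trans (*-congˡ (*-congʳ (M-sym i j)))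
      (solve 3 (λ x m y → x :* (m :* y) := y :* (m :* x)) refl (x i) (M j i) (y j))

  form-linearˡ : ∀ (M : Matrix n) a b x y z →
    ⟨ (λ i → a * x i + b * y i) , M · z ⟩ ≈ a * ⟨ x , M · z ⟩ + b * ⟨ y , M · z ⟩
  form-linearˡ M a b x y z = ⟨⟩-linearˡ a b x y (M · z)

  ·-linear : ∀ (M : Matrix n) a b x y i →
    (M · (λ j → a * x j + b * y j)) i ≈ a * (M · x) i + b * (M · y) i
  ·-linear M a b x y i = ⟨⟩-linearʳ a b x y (M i)

  form-linearʳ : ∀ (M : Matrix n) a b x y z →
    ⟨ z , M · (λ i → a * x i + b * y i) ⟩ ≈ a * ⟨ z , M · x ⟩ + b * ⟨ z , M · y ⟩
  form-linearʳ M a b x y z = trans (⟨⟩-cong (λ _ → refl) (·-linear M a b x y)) (⟨⟩-linearʳ a b (M · x) (M · y) z)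

  form-quadratic : {M : Matrix n} → Symmetric M → ∀ a b x y → let z = λ i → a * x i + b * y i in
    ⟨ z , M · z ⟩ ≈ a * a * ⟨ x , M · x ⟩ + (a * b + a * b) * ⟨ x , M · y ⟩ + b * b * ⟨ y , M · y ⟩
  form-quadratic {M = M} M-sym a b x y = begin-equality
    ⟨ z , M · z ⟩
      ≈⟨ form-linearˡ M a b x y z ⟩
    a * ⟨ x , M · z ⟩ + b * ⟨ y , M · z ⟩
      ≈⟨ +-cong (*-congˡ (form-linearʳ M a b x y x)) (*-congˡ (form-linearʳ M a b x y y)) ⟩
    a * (a * ⟨ x , M · x ⟩ + b * ⟨ x , M · y ⟩) + b * (a * ⟨ y , M · x ⟩ + b * ⟨ y , M · y ⟩)
      ≈⟨ +-congˡ (*-congˡ (+-congʳ (*-congˡ (form-symmetric M-sym y x)))) ⟩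
    a * (a * ⟨ x , M · x ⟩ + b * ⟨ x , M · y ⟩) + b * (a * ⟨ x , M · y ⟩ + b * ⟨ y , M · y ⟩)
      ≈⟨ solve 5 (λ a b p q r → a :* (a :* p :+ b :* q) :+ b :* (a :* q :+ b :* r)
                             := a :* a :* p :+ (a :* b :+ a :* b) :* q :+ b :* b :* r)
           refl a b ⟨ x , M · x ⟩ ⟨ x , M · y ⟩ ⟨ y , M · y ⟩ ⟩
    a * a * ⟨ x , M · x ⟩ + (a * b + a * b) * ⟨ x , M · y ⟩ + b * b * ⟨ y , M · y ⟩ ∎
    where z = λ i → a * x i + b * y i

  HyperbolicMatrix : Matrix n → Set
  HyperbolicMatrix M = ∀ x y → 0# < ⟨ y , M · y ⟩ →
    ⟨ x , M · x ⟩ * ⟨ y , M · y ⟩ ≤ ⟨ x , M · y ⟩ * ⟨ x , M · y ⟩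

  -- For z = ⟨h,My⟩x − ⟨h,Mx⟩y the bound ⟨z,Mz⟩ ≤ 0 says that a quadratic in
  -- ⟨h,Mx⟩ is nonpositive; completing the square gives the inequality up to
  -- the factor ⟨h,My⟩², which is positive because ⟨y,My⟩ is.
  nonPos-on-complement⇒hyperbolic : {M : Matrix n} → Symmetric M → ∀ h →
    (∀ z → ⟨ h , M · z ⟩ ≈ 0# → ⟨ z , M · z ⟩ ≤ 0#) → HyperbolicMatrix M
  nonPos-on-complement⇒hyperbolic {M = M} M-sym h nonPos x y 0<r = ≤-stable λ k →
    0<x⊎x≤0 (b * b) λ where
      (inj₂ bb≤0) → <⇒≱ 0<r (nonPos y (x*x≤0⇒x≈0 bb≤0))
      (inj₁ 0<bb) → k (*-cancelˡ-≤ 0<bb (0≤y-x⇒x≤y (begin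
        0#
          ≤⟨ +-nonNeg (0≤x*x (b * q - a * r)) (*-nonNeg (<⇒≤ 0<r) (x≤0⇒0≤-x (nonPos z hz≈0))) ⟩
        (b * q - a * r) * (b * q - a * r) + r * - ⟨ z , M · z ⟩
          ≈⟨ +-congˡ (*-congˡ (-‿cong (form-quadratic M-sym b (- a) x y))) ⟩
        (b * q - a * r) * (b * q - a * r) + r * - (b * b * p + (b * - a + b * - a) * q + - a * - a * r)
          ≈⟨ solve 5 (λ a b p q r →
                 (b :* q :- a :* r) :* (b :* q :- a :* r)
                   :+ r :* :- (b :* b :* p :+ (b :* :- a :+ b :* :- a) :* q :+ :- a :* :- a :* r)
               := b :* b :* (q :* q) :- b :* b :* (p :* r)) refl a b p q r ⟩
        b * b * (q * q) - b * b * (p * r) ∎)))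
    where
    a = ⟨ h , M · x ⟩
    b = ⟨ h , M · y ⟩
    p = ⟨ x , M · x ⟩
    q = ⟨ x , M · y ⟩
    r = ⟨ y , M · y ⟩
    z = λ i → b * x i + - a * y i
    hz≈0 : ⟨ h , M · z ⟩ ≈ 0#
    hz≈0 = trans (form-linearʳ M b (- a) x y h)
      (trans (solve 2 (λ a b → b :* a :+ :- a :* b := a :- a) refl a b) (-‿inverseʳ a))

  sum-distrib-- : (f g : Vector Carrier n) → sum (λ i → f i - g i) ≈ sum f - sum g
  sum-distrib-- {zero}  f g = sym (-‿inverseʳ 0#)
  sum-distrib-- {suc n} f g = trans (+-congˡ (sum-distrib-- (f ∘ suc) (g ∘ suc)))
    (solve 4 (λ a b s t → (a :- b) :+ (s :- t) := (a :+ s) :- (b :+ t)) refl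
      (f zero) (g zero) (sum (f ∘ suc)) (sum (g ∘ suc)))

  -- Orthogonal projection onto the span of finitely many vectors

  ⟨⟩-sumʳ : (r : Vector Carrier m) (w : Vector Carrier n) (a : Fin n → Vector Carrier m) →
    ⟨ r , (λ i → sum (λ j → w j * a j i)) ⟩ ≈ sum (λ j → w j * ⟨ r , a j ⟩)
  ⟨⟩-sumʳ r w a = begin-equality
    sum (λ i → r i * sum (λ j → w j * a j i))   ≈⟨ sum-cong-≋ (λ i → *-distribˡ-sum (r i) (λ j → w j * a j i)) ⟩
    sum (λ i → sum (λ j → r i * (w j * a j i))) ≈⟨ ∑-comm (λ i j → r i * (w j * a j i)) ⟩
    sum (λ j → sum (λ i → r i * (w j * a j i))) ≈⟨ sum-cong-≋ (λ j → sum-cong-≋ λ i → swap i j) ⟩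
    sum (λ j → sum (λ i → w j * (r i * a j i))) ≈⟨ sum-cong-≋ (λ j → *-distribˡ-sum (w j) (λ i → r i * a j i)) ⟨
    sum (λ j → w j * sum (λ i → r i * a j i))   ∎
    where
    swap : ∀ i j → r i * (w j * a j i) ≈ w j * (r i * a j i)
    swap i j = solve 3 (λ r w a → r :* (w :* a) := w :* (r :* a)) refl (r i) (w j) (a j i)

  -- The orthogonal projection of `b` onto the span of the `a j`, with coefficients `w` and residual
  -- `r`. Uniqueness of `w` is not claimed, so the `a j` may be linearly dependent.
  Decomposition : (Fin n → Vector Carrier m) → Vector Carrier m → Set
  Decomposition {n} {m} a b = Σ[ w ∈ Vector Carrier n ] Σ[ r ∈ Vector Carrier m ]
    (∀ i → b i ≈ sum (λ j → w j * a j i) + r i) × (∀ j → ⟨ r , a j ⟩ ≈ 0#)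

  -- A Gram–Schmidt step: r₀ is the component of the new vector a₀ orthogonal
  -- to the old ones.
  extend-decomposition : (a : Fin (suc n) → Vector Carrier m) (b : Vector Carrier m) →
    Decomposition (a ∘ suc) (a zero) → Decomposition (a ∘ suc) b → ¬ ¬ Decomposition a b
  extend-decomposition a b (w₀ , r₀ , a₀≈ , r₀⊥) (w₁ , r₁ , b≈ , r₁⊥) =
    ¬¬-map [ independent , dependent ]′ (0<x⊎x≤0 ⟨ r₀ , r₀ ⟩)
    where
    a′ = a ∘ suc

    -- `a zero` and `r₀` differ by a combination of the old vectors, to all of which `r` is
    -- orthogonal.
    ⟨r,a₀⟩ : ∀ r → (∀ j → ⟨ r , a′ j ⟩ ≈ 0#) → ⟨ r , a zero ⟩ ≈ ⟨ r , r₀ ⟩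
    ⟨r,a₀⟩ r r⊥ = begin-equality
      ⟨ r , a zero ⟩
        ≈⟨ sum-cong-≋ (λ i → trans (*-congˡ (a₀≈ i)) (distribˡ (r i) _ _)) ⟩
      sum (λ i → r i * sum (λ j → w₀ j * a′ j i) + r i * r₀ i)
        ≈⟨ ∑-distrib-+ (λ i → r i * sum (λ j → w₀ j * a′ j i)) (λ i → r i * r₀ i) ⟩
      ⟨ r , (λ i → sum (λ j → w₀ j * a′ j i)) ⟩ + ⟨ r , r₀ ⟩
        ≈⟨ +-congʳ (⟨⟩-sumʳ r w₀ a′) ⟩
      sum (λ j → w₀ j * ⟨ r , a′ j ⟩) + ⟨ r , r₀ ⟩
        ≈⟨ +-congʳ (sum-zero λ j → trans (*-congˡ (r⊥ j)) (zeroʳ (w₀ j))) ⟩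
      0# + ⟨ r , r₀ ⟩
        ≈⟨ +-identityˡ _ ⟩
      ⟨ r , r₀ ⟩ ∎

    dependent : ⟨ r₀ , r₀ ⟩ ≤ 0# → Decomposition a b
    -- Here `r₀` vanishes, so `a zero` lies in the span of the old vectors: it gets coefficient 0
    -- and the residual stays.
    dependent ⟨r₀,r₀⟩≤0 = 0# Vector.∷ w₁ , r₁
      , (λ i → trans (b≈ i) (+-congʳ (sym (trans (+-congʳ (zeroˡ (a zero i))) (+-identityˡ _)))))
      , λ { zero    → trans (⟨r,a₀⟩ r₁ r₁⊥) (sum-zero λ i → trans (*-congˡ (r₀≈0 i)) (zeroʳ (r₁ i)))
          ; (suc j) → r₁⊥ j }
      where r₀≈0 = ⟨x,x⟩≤0⇒x≈0 r₀ ⟨r₀,r₀⟩≤0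

    independent : 0# < ⟨ r₀ , r₀ ⟩ → Decomposition a b
    independent 0<⟨r₀,r₀⟩ = c Vector.∷ w , r , split , λ { zero → r⊥₀ ; (suc j) → r⊥ j }
      where
      s = ⟨ r₀ , r₀ ⟩
      t = proj₁ (inverse 0<⟨r₀,r₀⟩)
      p = ⟨ r₁ , r₀ ⟩
      -- `t` is the inverse of `s`, so `c` is the coefficient of `r₀` in the projection of `r₁` onto
      -- it. The factor `u`, which is 1, gives `r` and `w` the shape of a linear combination, and as
      -- an image of a rational it is a constant to the solver.
      c = p * t
      u = ⟦ ℚ.1ℚ ⟧
      r = λ i → u * r₁ i + - c * r₀ i
      w = λ j → u * w₁ j + - c * w₀ j

      r⊥ : ∀ j → ⟨ r , a′ j ⟩ ≈ 0#
      r⊥ j = begin-equality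
        ⟨ r , a′ j ⟩                            ≈⟨ ⟨⟩-linearˡ u (- c) r₁ r₀ (a′ j) ⟩
        u * ⟨ r₁ , a′ j ⟩ + - c * ⟨ r₀ , a′ j ⟩ ≈⟨ +-cong (*-congˡ (r₁⊥ j)) (*-congˡ (r₀⊥ j)) ⟩
        u * 0# + - c * 0#                       ≈⟨ +-cong (zeroʳ u) (zeroʳ (- c)) ⟩
        0# + 0#                                 ≈⟨ +-identityˡ 0# ⟩
        0#                                      ∎

      r⊥₀ : ⟨ r , a zero ⟩ ≈ 0#
      r⊥₀ = begin-equality
        ⟨ r , a zero ⟩  ≈⟨ ⟨r,a₀⟩ r r⊥ ⟩
        ⟨ r , r₀ ⟩      ≈⟨ ⟨⟩-linearˡ u (- c) r₁ r₀ r₀ ⟩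
        u * p + - c * s ≈⟨ solve 3 (λ p s t → con ℚ.1ℚ :* p :+ :- (p :* t) :* s := p :- p :* (s :* t))
                             refl p s t ⟩
        p - p * (s * t) ≈⟨ +-congˡ (-‿cong (trans (*-congˡ (proj₂ (proj₂ (inverse 0<⟨r₀,r₀⟩)))) (*-identityʳ p))) ⟩
        p - p           ≈⟨ -‿inverseʳ p ⟩
        0#              ∎

      split : ∀ i → b i ≈ (c * a zero i + sum (λ j → w j * a′ j i)) + r i
      split i = begin-equality
        b i
          ≈⟨ b≈ i ⟩
        S₁ + r₁ i
          ≈⟨ solve 5 (λ c S₀ S₁ x y → S₁ :+ y
                := (c :* (S₀ :+ x) :+ (con ℚ.1ℚ :* S₁ :+ :- c :* S₀)) :+ (con ℚ.1ℚ :* y :+ :- c :* x))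
               refl c S₀ S₁ (r₀ i) (r₁ i) ⟩
        (c * (S₀ + r₀ i) + (u * S₁ + - c * S₀)) + r i
          ≈⟨ +-congʳ (+-cong (*-congˡ (a₀≈ i)) (⟨⟩-linearˡ u (- c) w₁ w₀ (λ j → a′ j i))) ⟨
        (c * a zero i + sum (λ j → w j * a′ j i)) + r i ∎
        where
        S₀ = sum (λ j → w₀ j * a′ j i)
        S₁ = sum (λ j → w₁ j * a′ j i)

  -- The double negation arises because each step asks whether the new vector depends on the old
  -- ones. The target `b` varies in the induction, since `a zero` has to be decomposed as well.
  orthogonal-decomposition : (a : Fin n → Vector Carrier m) (b : Vector Carrier m) → ¬ ¬ Decomposition a b
  orthogonal-decomposition {zero}  a b k = k ((λ ()) , b , (λ i → sym (+-identityˡ (b i))) , λ ())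
  orthogonal-decomposition {suc n} a b k =
    orthogonal-decomposition (a ∘ suc) (a zero) λ a₀-decomposition →
    orthogonal-decomposition (a ∘ suc) b λ b-decomposition →
    extend-decomposition a b a₀-decomposition b-decomposition k

  -- Kronecker delta and change of index set

  δ : Fin n → Fin n → Carrier
  δ zero    zero    = 1#
  δ zero    (suc j) = 0#
  δ (suc i) zero    = 0#
  δ (suc i) (suc j) = δ i j

  δ-sym : (i j : Fin n) → δ i j ≈ δ j i
  δ-sym zero    zero    = refl
  δ-sym zero    (suc j) = refl
  δ-sym (suc i) zero    = refl
  δ-sym (suc i) (suc j) = δ-sym i j

  δ-refl : (i : Fin n) → δ i i ≈ 1#
  δ-refl zero    = refl
  δ-refl (suc i) = δ-refl i

  δ-≢ : {i j : Fin n} → i ≢ j → δ i j ≈ 0#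
  δ-≢ {i = zero}  {zero}  i≢j = contradiction ≡.refl i≢j
  δ-≢ {i = zero}  {suc j} i≢j = refl
  δ-≢ {i = suc i} {zero}  i≢j = refl
  δ-≢ {i = suc i} {suc j} i≢j = δ-≢ (i≢j ∘ ≡.cong suc)

  δ-injective : {φ : Fin n → Fin m} → Injective _≡_ _≡_ φ → ∀ i j → δ (φ i) (φ j) ≈ δ i j
  δ-injective {φ = φ} φ-inj i j with i Fin.≟ j
  ... | yes ≡.refl = trans (δ-refl (φ i)) (sym (δ-refl i))
  ... | no  i≢j    = trans (δ-≢ (i≢j ∘ φ-inj)) (sym (δ-≢ i≢j))

  δ-* : (i j : Fin n) (f : Vector Carrier n) → δ i j * f i ≈ δ j i * f j
  δ-* i j f with i Fin.≟ j
  ... | yes ≡.refl = refl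
  ... | no  i≢j    = trans (trans (*-congʳ (δ-≢ i≢j)) (zeroˡ (f i)))
                           (sym (trans (*-congʳ (δ-≢ (i≢j ∘ ≡.sym))) (zeroˡ (f j))))

  sum-δ : (i : Fin n) (f : Vector Carrier n) → sum (λ j → δ i j * f j) ≈ f i
  sum-δ zero    f = trans (+-cong (*-identityˡ (f zero)) (sum-zero λ j → zeroˡ (f (suc j)))) (+-identityʳ (f zero))
  sum-δ (suc i) f = trans (+-cong (zeroˡ (f zero)) (sum-δ i (f ∘ suc))) (+-identityˡ (f (suc i)))

  -- Each `f i` is spread out as a sum over `k` weighted by `δ (φ k) i`. Injectivity leaves at most
  -- one surviving term, and exchanging the two sums collapses the other delta.
  sum-reindex : {φ : Fin n → Fin m} → Injective _≡_ _≡_ φ → (f : Vector Carrier m) →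
    (∀ i → (∀ k → φ k ≢ i) → f i ≈ 0#) → sum f ≈ sum (f ∘ φ)
  sum-reindex {φ = φ} φ-inj f f≈0 = begin-equality
    sum f                                            ≈⟨ sum-cong-≋ spread ⟩
    sum (λ i → sum (λ k → δ (φ k) i * f (φ k)))      ≈⟨ ∑-comm (λ i k → δ (φ k) i * f (φ k)) ⟩
    sum (λ k → sum (λ i → δ (φ k) i * f (φ k)))      ≈⟨ sum-cong-≋ (λ k → sum-δ (φ k) (λ _ → f (φ k))) ⟩
    sum (λ k → f (φ k))                              ∎
    where
    spread : ∀ i → f i ≈ sum (λ k → δ (φ k) i * f (φ k))
    spread i with Fin.any? (λ k → φ k Fin.≟ i)
    ... | yes (k , ≡.refl) = sym (trans
      (sum-cong-≋ λ l → *-congʳ (trans (δ-injective φ-inj l k) (δ-sym l k)))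
      (sum-δ k (f ∘ φ)))
    ... | no ∄k = trans (f≈0 i (curry ∄k)) (sym (sum-zero λ k →
      trans (*-congʳ (δ-≢ (curry ∄k k))) (zeroˡ (f (φ k)))))

  -- Weighted graphs and their Laplacians

  ⟨constant,b⟩≈0 : {r b : Vector Carrier n} → (∀ i j → r i ≈ r j) → sum b ≈ 0# → ⟨ r , b ⟩ ≈ 0#
  ⟨constant,b⟩≈0 {zero}          r-constant ∑b≈0 = refl
  ⟨constant,b⟩≈0 {suc n} {r} {b} r-constant ∑b≈0 = begin-equality
    ⟨ r , b ⟩                ≈⟨ sum-cong-≋ (λ j → *-congʳ {b j} (r-constant j zero)) ⟩
    sum (λ j → r zero * b j) ≈⟨ *-distribˡ-sum (r zero) b ⟨
    r zero * sum b           ≈⟨ *-congˡ ∑b≈0 ⟩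
    r zero * 0#              ≈⟨ zeroʳ (r zero) ⟩
    0#                       ∎

  -- Connectedness by cuts instead of paths: this is what irreducibility yields, and a level set of
  -- a kernel vector supplies the cut to apply it to. The conclusion is a negation, as a nonzero
  -- entry cannot be searched for among reals.
  Connected : Matrix n → Set
  Connected {n} C = (P : Fin n → Bool) → ∀ i j → P i ≡ true → P j ≡ false →
    ¬ (∀ i j → P i ≡ true → P j ≡ false → C i j ≈ 0#)

  module Laplacian (C : Matrix n) (C-sym : Symmetric C) (C-nonNeg : ∀ i j → 0# ≤ C i j) where

    deg : Vector Carrier n
    deg i = sum (C i)

    L : Matrix n
    L i j = δ i j * deg i - C i j

    L-sym : Symmetric L
    L-sym i j = +-cong (δ-* i j deg) (-‿cong (C-sym i j))

    L· : ∀ u i → (L · u) i ≈ deg i * u i - (C · u) i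
    L· u i = begin-equality
      sum (λ j → (δ i j * deg i - C i j) * u j)
        ≈⟨ sum-cong-≋ (λ j → solve 4 (λ δ d c u → (δ :* d :- c) :* u := δ :* (d :* u) :- c :* u)
                                refl (δ i j) (deg i) (C i j) (u j)) ⟩
      sum (λ j → δ i j * (deg i * u j) - C i j * u j)
        ≈⟨ sum-distrib-- (λ j → δ i j * (deg i * u j)) (λ j → C i j * u j) ⟩
      sum (λ j → δ i j * (deg i * u j)) - (C · u) i
        ≈⟨ +-congʳ (sum-δ i (λ j → deg i * u j)) ⟩
      deg i * u i - (C · u) i ∎

    -- The Dirichlet form of the graph. The sum runs over ordered pairs, so each edge counts twice;
    -- hence the factor 2 against ⟨u,Lu⟩.
    energy : Vector Carrier n → Carrier
    energy u = sum (λ i → sum (λ j → C i j * ((u i - u j) * (u i - u j))))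

    energy-term-nonNeg : ∀ (u : Vector Carrier n) i j → 0# ≤ C i j * ((u i - u j) * (u i - u j))
    energy-term-nonNeg u i j = *-nonNeg (C-nonNeg i j) (0≤x*x (u i - u j))

    energy≈2⟨u,Lu⟩ : ∀ u → energy u ≈ ⟨ u , L · u ⟩ + ⟨ u , L · u ⟩
    energy≈2⟨u,Lu⟩ u = begin-equality
      energy u
        ≈⟨ sum-cong-≋ (λ i → sum-cong-≋ (expand i)) ⟩
      sum (λ i → sum (λ j → A i j + A j i))
        ≈⟨ sum-cong-≋ (λ i → ∑-distrib-+ (A i) (λ j → A j i)) ⟩
      sum (λ i → sum (A i) + sum (λ j → A j i))
        ≈⟨ ∑-distrib-+ (λ i → sum (A i)) (λ i → sum (λ j → A j i)) ⟩
      sum (λ i → sum (A i)) + sum (λ i → sum (λ j → A j i))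
        ≈⟨ +-congˡ (∑-comm (λ i j → A j i)) ⟩
      sum (λ i → sum (A i)) + sum (λ i → sum (A i))
        ≈⟨ +-cong (sum-cong-≋ row) (sum-cong-≋ row) ⟩
      ⟨ u , L · u ⟩ + ⟨ u , L · u ⟩ ∎
      where
      -- The square `C i j * (u i - u j)²` is `A i j` plus its transpose; both halves have the same
      -- total, and the row sums of `A` are the terms of ⟨u,Lu⟩.
      A : Matrix n
      A i j = u i * (C i j * u i - C i j * u j)

      expand : ∀ i j → C i j * ((u i - u j) * (u i - u j)) ≈ A i j + A j i
      expand i j = trans
        (solve 3 (λ c x y → c :* ((x :- y) :* (x :- y)) := x :* (c :* x :- c :* y) :+ y :* (c :* y :- c :* x))
          refl (C i j) (u i) (u j))
        (+-congˡ (*-congˡ (+-cong (*-congʳ (C-sym i j)) (-‿cong (*-congʳ (C-sym i j))))))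

      row : ∀ i → sum (A i) ≈ u i * (L · u) i
      row i = begin-equality
        sum (A i)
          ≈⟨ *-distribˡ-sum (u i) (λ j → C i j * u i - C i j * u j) ⟨
        u i * sum (λ j → C i j * u i - C i j * u j)
          ≈⟨ *-congˡ (sum-distrib-- (λ j → C i j * u i) (λ j → C i j * u j)) ⟩
        u i * (sum (λ j → C i j * u i) - (C · u) i)
          ≈⟨ *-congˡ (+-congʳ (*-distribʳ-sum (u i) (C i))) ⟨
        u i * (deg i * u i - (C · u) i)
          ≈⟨ *-congˡ (L· u i) ⟨
        u i * (L · u) i ∎

    L-nonNeg : ∀ u → 0# ≤ ⟨ u , L · u ⟩
    L-nonNeg u = 0≤x+x⇒0≤x (≤-respʳ-≈ (energy≈2⟨u,Lu⟩ u)
      (sum-nonNeg λ i → sum-nonNeg λ j → energy-term-nonNeg u i j))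

    -- A kernel vector has energy zero, so every one of the nonnegative terms vanishes, and a
    -- positive weight can be cancelled.
    kernel-adjacent : ∀ {u : Vector Carrier n} → (∀ i → (L · u) i ≈ 0#) → ∀ i j → 0# < C i j → u i ≈ u j
    kernel-adjacent {u} Lu≈0 i j 0<Cij = begin-equality
      u i             ≈⟨ solve 2 (λ x y → x := y :+ (x :- y)) refl (u i) (u j) ⟩
      u j + (u i - u j) ≈⟨ +-congˡ (x*x≤0⇒x≈0 (≤-reflexive (*-cancelˡ-≈0 0<Cij (antisym term≤0 (energy-term-nonNeg u i j))))) ⟩
      u j + 0#        ≈⟨ +-identityʳ (u j) ⟩
      u j             ∎
      where
      ⟨u,Lu⟩≈0 : ⟨ u , L · u ⟩ ≈ 0#
      ⟨u,Lu⟩≈0 = sum-zero λ i → trans (*-congˡ (Lu≈0 i)) (zeroʳ (u i))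

      term≤0 : C i j * ((u i - u j) * (u i - u j)) ≤ 0#
      term≤0 = begin
        C i j * ((u i - u j) * (u i - u j))
          ≤⟨ term≤sum (λ j → C i j * ((u i - u j) * (u i - u j))) (energy-term-nonNeg u i) j ⟩
        sum (λ j → C i j * ((u i - u j) * (u i - u j)))
          ≤⟨ term≤sum (λ i → sum (λ j → C i j * ((u i - u j) * (u i - u j)))) (λ i → sum-nonNeg (energy-term-nonNeg u i)) i ⟩
        energy u
          ≈⟨ energy≈2⟨u,Lu⟩ u ⟩
        ⟨ u , L · u ⟩ + ⟨ u , L · u ⟩
          ≈⟨ +-cong ⟨u,Lu⟩≈0 ⟨u,Lu⟩≈0 ⟩
        0# + 0#
          ≈⟨ +-identityˡ 0# ⟩
        0# ∎

    -- The vertices where `u` differs from `u j` form one side of a cut, decided under double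
    -- negation. By `kernel-adjacent` no positive weight crosses it, so connectedness forbids `i` on
    -- that side.
    kernel-constant : Connected C → ∀ {u : Vector Carrier n} → (∀ i → (L · u) i ≈ 0#) → ∀ i j → u i ≈ u j
    kernel-constant connected {u} Lu≈0 i j = ≈-stable λ ui≉uj →
      ¬¬-sequence {P = λ k → Dec (u k ≈ u j)} (λ _ → ¬¬-excluded-middle) λ ≈uj? →
      connected (λ k → not (does (≈uj? k))) i j
        (≡.cong not (dec-false (≈uj? i) ui≉uj))
        (≡.cong not (dec-true (≈uj? j) refl))
        (separated ≈uj?)
      where
      separated : (≈uj? : ∀ k → Dec (u k ≈ u j)) → ∀ k l →
        not (does (≈uj? k)) ≡ true → not (does (≈uj? l)) ≡ false → C k l ≈ 0#
      separated ≈uj? k l p q with ≈uj? k | ≈uj? l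
      ... | no uk≉uj | yes ul≈uj = antisym
        (≮⇒≥ λ 0<Ckl → uk≉uj (trans (kernel-adjacent Lu≈0 k l 0<Ckl) ul≈uj)) (C-nonNeg k l)
      separated ≈uj? k l () q | yes _ | _
      separated ≈uj? k l p () | no _ | no _

    -- The Fredholm alternative. Project `b` onto the rows of the symmetric matrix `L`: the residual
    -- `r` lies in the kernel, so it is constant and orthogonal to `b`. It is also orthogonal to
    -- `L · w`, hence to itself.
    solvable : Connected C → ∀ b → sum b ≈ 0# → ¬ ¬ (Σ[ w ∈ Vector Carrier n ] (∀ i → (L · w) i ≈ b i))
    solvable connected b ∑b≈0 = ¬¬-map solution (orthogonal-decomposition L b)
      where
      solution : Decomposition L b → Σ[ w ∈ Vector Carrier n ] (∀ i → (L · w) i ≈ b i)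
      solution (w , r , b≈ , r⊥) = w , λ i → sym (begin-equality
        b i             ≈⟨ b≈′ i ⟩
        (L · w) i + r i ≈⟨ +-congˡ (⟨x,x⟩≤0⇒x≈0 r (≤-reflexive ⟨r,r⟩≈0) i) ⟩
        (L · w) i + 0#  ≈⟨ +-identityʳ _ ⟩
        (L · w) i       ∎)
        where
        b≈′ : ∀ i → b i ≈ (L · w) i + r i
        b≈′ i = trans (b≈ i) (+-congʳ (sum-cong-≋ λ j → trans (*-comm (w j) (L j i)) (*-congʳ (L-sym j i))))

        Lr≈0 : ∀ i → (L · r) i ≈ 0#
        Lr≈0 i = trans (⟨⟩-comm (L i) r) (r⊥ i)

        ⟨r,Lw⟩≈0 : ⟨ r , L · w ⟩ ≈ 0#
        ⟨r,Lw⟩≈0 = trans (form-symmetric L-sym r w) (sum-zero λ i → trans (*-congˡ (Lr≈0 i)) (zeroʳ (w i)))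

        ⟨r,r⟩≈0 : ⟨ r , r ⟩ ≈ 0#
        ⟨r,r⟩≈0 = begin-equality
          ⟨ r , r ⟩                   ≈⟨ +-identityˡ _ ⟨
          0# + ⟨ r , r ⟩              ≈⟨ +-congʳ ⟨r,Lw⟩≈0 ⟨
          ⟨ r , L · w ⟩ + ⟨ r , r ⟩   ≈⟨ ∑-distrib-+ (λ i → r i * (L · w) i) (λ i → r i * r i) ⟨
          sum (λ i → r i * (L · w) i + r i * r i) ≈⟨ sum-cong-≋ (λ i → trans (*-congˡ (b≈′ i)) (distribˡ (r i) _ _)) ⟨
          ⟨ r , b ⟩                   ≈⟨ ⟨constant,b⟩≈0 (kernel-constant connected Lr≈0) ∑b≈0 ⟩
          0#                          ∎

    module _ (e : Vector Carrier n) (deg*e≈1 : ∀ i → deg i * e i ≈ 1#)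
             (C-bound : ∀ u → ⟨ u , C · u ⟩ ≤ sum (λ i → e i * ((C · u) i * (C · u) i))) where

      -- The difference of the two sides is the same for `C` as for `L`, term by term: with `L · u`
      -- equal to `deg * u - C · u`, the expression `e * s * s - u * s` takes equal values at
      -- `s = (C · u) i` and `s = (L · u) i`.
      L-bound : ∀ u → ⟨ u , L · u ⟩ ≤ sum (λ i → e i * ((L · u) i * (L · u) i))
      L-bound u = 0≤y-x⇒x≤y (begin
        0#
          ≤⟨ x≤y⇒0≤y-x (C-bound u) ⟩
        sum (λ i → e i * ((C · u) i * (C · u) i)) - ⟨ u , C · u ⟩
          ≈⟨ sum-distrib-- (λ i → e i * ((C · u) i * (C · u) i)) (λ i → u i * (C · u) i) ⟨
        sum (λ i → e i * ((C · u) i * (C · u) i) - u i * (C · u) i)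
          ≈⟨ sum-cong-≋ exchange ⟩
        sum (λ i → e i * ((L · u) i * (L · u) i) - u i * (L · u) i)
          ≈⟨ sum-distrib-- (λ i → e i * ((L · u) i * (L · u) i)) (λ i → u i * (L · u) i) ⟩
        sum (λ i → e i * ((L · u) i * (L · u) i)) - ⟨ u , L · u ⟩ ∎)
        where
        exchange : ∀ i → e i * ((C · u) i * (C · u) i) - u i * (C · u) i ≈ e i * ((L · u) i * (L · u) i) - u i * (L · u) i
        exchange i = begin-equality
          E * (c * c) - x * c
            ≈⟨ solve 4 (λ E c x D → E :* (c :* c) :- x :* c
                 := (D :* x :* x :- (x :* c :+ x :* c)) :+ (E :* (c :* c) :- D :* x :* x :+ x :* c)) refl E c x D ⟩
          t + (E * (c * c) - D * x * x + x * c)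
            ≈⟨ +-congʳ (trans (*-congʳ (deg*e≈1 i)) (*-identityˡ t)) ⟨
          D * E * t + (E * (c * c) - D * x * x + x * c)
            ≈⟨ solve 4 (λ E c x D → D :* E :* (D :* x :* x :- (x :* c :+ x :* c)) :+ (E :* (c :* c) :- D :* x :* x :+ x :* c)
                 := E :* ((D :* x :- c) :* (D :* x :- c)) :- x :* (D :* x :- c)) refl E c x D ⟩
          E * ((D * x - c) * (D * x - c)) - x * (D * x - c)
            ≈⟨ +-cong (*-congˡ (*-cong (L· u i) (L· u i))) (-‿cong (*-congˡ (L· u i))) ⟨
          E * ((L · u) i * (L · u) i) - x * (L · u) i ∎
          where
          E = e i
          D = deg i
          c = (C · u) i
          x = u i
          -- The part to be multiplied by `D * E`, which is 1, before the two sides agree as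
          -- polynomials.
          t = D * x * x - (x * c + x * c)

      -- If L w = deg y then the bound at w reads ⟨w,Lw⟩ ≤ ⟨y, deg y⟩ = ⟨y,Lw⟩, so
      -- 0 ≤ ⟨y−w,L(y−w)⟩ yields ⟨y, deg y⟩ ≤ ⟨y,Ly⟩ = ⟨y, deg y⟩ − ⟨y,Cy⟩.
      nonPos-on-complement : Connected C → ∀ y → sum (C · y) ≈ 0# → ⟨ y , C · y ⟩ ≤ 0#
      nonPos-on-complement connected y ∑Cy≈0 = ≤-stable (¬¬-map bound (solvable connected b ∑b≈0))
        where
        b : Vector Carrier n
        b i = deg i * y i

        ∑b≈0 : sum b ≈ 0#
        ∑b≈0 = begin-equality
          sum (λ i → deg i * y i)               ≈⟨ sum-cong-≋ (λ i → *-distribʳ-sum (y i) (C i)) ⟩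
          sum (λ i → sum (λ j → C i j * y i))   ≈⟨ ∑-comm (λ i j → C i j * y i) ⟩
          sum (λ j → sum (λ i → C i j * y i))   ≈⟨ sum-cong-≋ (λ j → sum-cong-≋ λ i → *-congʳ (C-sym i j)) ⟩
          sum (C · y)                           ≈⟨ ∑Cy≈0 ⟩
          0#                                    ∎

        q = ⟨ y , b ⟩

        ⟨y,Ly⟩≈ : ⟨ y , L · y ⟩ ≈ q - ⟨ y , C · y ⟩
        ⟨y,Ly⟩≈ = trans
          (sum-cong-≋ λ i → trans (*-congˡ (L· y i))
            (solve 3 (λ x b c → x :* (b :- c) := x :* b :- x :* c) refl (y i) (b i) ((C · y) i)))
          (sum-distrib-- (λ i → y i * b i) (λ i → y i * (C · y) i))

        ∑eb²≈q : sum (λ i → e i * (b i * b i)) ≈ q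
        ∑eb²≈q = sum-cong-≋ λ i → begin-equality
          e i * (deg i * y i * b i)  ≈⟨ solve 4 (λ e d y b → e :* (d :* y :* b) := d :* e :* (y :* b))
                                          refl (e i) (deg i) (y i) (b i) ⟩
          deg i * e i * (y i * b i)  ≈⟨ *-congʳ (deg*e≈1 i) ⟩
          1# * (y i * b i)           ≈⟨ *-identityˡ _ ⟩
          y i * b i                  ∎

        bound : (Σ[ w ∈ Vector Carrier n ] (∀ i → (L · w) i ≈ b i)) → ⟨ y , C · y ⟩ ≤ 0#
        bound (w , Lw≈b) = 0≤y-x⇒x≤y (begin
          0#
            ≤⟨ +-nonNeg (L-nonNeg (λ i → ⟦ ℚ.1ℚ ⟧ * y i + ⟦ ℚ.- ℚ.1ℚ ⟧ * w i)) (x≤y⇒0≤y-x ⟨w,Lw⟩≤q) ⟩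
          ⟨ z , L · z ⟩ + (q - ⟨ w , L · w ⟩)
            ≈⟨ +-congʳ (trans (form-quadratic L-sym ⟦ ℚ.1ℚ ⟧ ⟦ ℚ.- ℚ.1ℚ ⟧ y w)
                 (+-congʳ (+-cong (*-congˡ ⟨y,Ly⟩≈) (*-congˡ ⟨y,Lw⟩≈q)))) ⟩
          𝟙 * 𝟙 * (q - p) + (𝟙 * -𝟙 + 𝟙 * -𝟙) * q + -𝟙 * -𝟙 * s + (q - s)
            ≈⟨ solve 3 (λ p q s → con ℚ.1ℚ :* con ℚ.1ℚ :* (q :- p)
                   :+ (con ℚ.1ℚ :* con (ℚ.- ℚ.1ℚ) :+ con ℚ.1ℚ :* con (ℚ.- ℚ.1ℚ)) :* q
                   :+ con (ℚ.- ℚ.1ℚ) :* con (ℚ.- ℚ.1ℚ) :* s :+ (q :- s) := :- p) refl p q s ⟩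
          - p
            ≈⟨ +-identityˡ (- p) ⟨
          0# - p ∎)
          where
          𝟙 = ⟦ ℚ.1ℚ ⟧
          -𝟙 = ⟦ ℚ.- ℚ.1ℚ ⟧
          z = λ i → 𝟙 * y i + -𝟙 * w i
          p = ⟨ y , C · y ⟩
          s = ⟨ w , L · w ⟩

          ⟨y,Lw⟩≈q : ⟨ y , L · w ⟩ ≈ q
          ⟨y,Lw⟩≈q = ⟨⟩-cong (λ _ → refl) Lw≈b

          ⟨w,Lw⟩≤q : ⟨ w , L · w ⟩ ≤ q
          ⟨w,Lw⟩≤q = ≤-trans (L-bound w) (≤-reflexive
            (trans (sum-cong-≋ λ i → *-congˡ (*-cong (Lw≈b i) (Lw≈b i))) ∑eb²≈q))

  -- From a matrix to the weighted graph on its support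

  module Restriction {d n} (M : Matrix d) (M-sym : Symmetric M) (M-nonNeg : ∀ i j → 0# ≤ M i j)
    (h : Vector Carrier d) (φ : Fin n → Fin d) (φ-injective : Injective _≡_ _≡_ φ)
    (M≈0-off-φ : ∀ i → (∀ k → φ k ≢ i) → ∀ j → M i j ≈ 0#)
    (h-pos : ∀ k → 0# < h (φ k)) (Mh-pos : ∀ k → 0# < (M · h) (φ k))
    where

    -- The substitution `x = h u` turns `h` into the constant vector 1, which spans the kernel of a
    -- connected Laplacian.
    C : Matrix n
    C k l = h (φ k) * (M (φ k) (φ l) * h (φ l))

    C-sym : Symmetric C
    C-sym k l = trans (*-congˡ (*-congʳ (M-sym (φ k) (φ l))))
      (solve 3 (λ x m y → x :* (m :* y) := y :* (m :* x)) refl (h (φ k)) (M (φ l) (φ k)) (h (φ l)))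

    C-nonNeg : ∀ k l → 0# ≤ C k l
    C-nonNeg k l = *-nonNeg (<⇒≤ (h-pos k)) (*-nonNeg (M-nonNeg (φ k) (φ l)) (<⇒≤ (h-pos l)))

    open Laplacian C C-sym C-nonNeg using (deg; nonPos-on-complement)

    -- A relation, because entries of `x` off the support are invisible to `M` and stay free. It is
    -- used both ways: `lift` produces `x` from `u` for the bound on `C`, and `nonPos` produces `u`
    -- from `z`.
    _Represents_ : Vector Carrier n → Vector Carrier d → Set
    u Represents x = ∀ k → x (φ k) ≈ h (φ k) * u k

    C·u≈ : ∀ {u x} → u Represents x → ∀ k → (C · u) k ≈ h (φ k) * (M · x) (φ k)
    C·u≈ {u} {x} u≈x k = begin-equality
      sum (λ l → h (φ k) * (M (φ k) (φ l) * h (φ l)) * u l)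
        ≈⟨ sum-cong-≋ (λ l → trans
             (solve 4 (λ a m b u → a :* (m :* b) :* u := a :* (m :* (b :* u))) refl (h (φ k)) (M (φ k) (φ l)) (h (φ l)) (u l))
             (*-congˡ (*-congˡ (sym (u≈x l))))) ⟩
      sum (λ l → h (φ k) * (M (φ k) (φ l) * x (φ l)))
        ≈⟨ *-distribˡ-sum (h (φ k)) (λ l → M (φ k) (φ l) * x (φ l)) ⟨
      h (φ k) * sum (λ l → M (φ k) (φ l) * x (φ l))
        ≈⟨ *-congˡ (sum-reindex φ-injective (λ j → M (φ k) j * x j) λ j j∉φ →
             trans (*-congʳ (trans (M-sym (φ k) j) (M≈0-off-φ j j∉φ (φ k)))) (zeroˡ (x j))) ⟨
      h (φ k) * (M · x) (φ k) ∎

    ⟨x,M·y⟩-reindex : ∀ x y → ⟨ x , M · y ⟩ ≈ sum (λ k → x (φ k) * (M · y) (φ k))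
    ⟨x,M·y⟩-reindex x y = sum-reindex φ-injective (λ i → x i * (M · y) i) λ i i∉φ →
      trans (*-congˡ (sum-zero λ j → trans (*-congʳ (M≈0-off-φ i i∉φ j)) (zeroˡ (y j)))) (zeroʳ (x i))

    ⟨u,C·u⟩≈ : ∀ {u x} → u Represents x → ⟨ u , C · u ⟩ ≈ ⟨ x , M · x ⟩
    ⟨u,C·u⟩≈ {u} {x} u≈x = trans
      (sum-cong-≋ λ k → trans (*-congˡ (C·u≈ {u} {x} u≈x k)) (trans
        (solve 3 (λ u a m → u :* (a :* m) := a :* u :* m) refl (u k) (h (φ k)) ((M · x) (φ k)))
        (*-congʳ (sym (u≈x k)))))
      (sym (⟨x,M·y⟩-reindex x x))

    deg≈ : ∀ k → deg k ≈ h (φ k) * (M · h) (φ k)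
    deg≈ k = trans (sum-cong-≋ λ l → sym (*-identityʳ (C k l)))
      (C·u≈ {λ _ → 1#} {h} (λ l → sym (*-identityʳ (h (φ l)))) k)

    deg-pos : ∀ k → 0# < deg k
    deg-pos k = <-≤-trans (*-pos (h-pos k) (Mh-pos k)) (≤-reflexive (sym (deg≈ k)))

    e : Vector Carrier n
    e k = proj₁ (inverse (deg-pos k))

    deg*e≈1 : ∀ k → deg k * e k ≈ 1#
    deg*e≈1 k = proj₂ (proj₂ (inverse (deg-pos k)))

    lift : Vector Carrier n → Vector Carrier d
    lift u i = sum (λ k → δ i (φ k) * (h (φ k) * u k))

    represents-lift : ∀ u → u Represents lift u
    represents-lift u k = trans
      (sum-cong-≋ λ l → *-congʳ (δ-injective φ-injective k l)) (sum-δ k (λ l → h (φ l) * u l))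

    -- `Φ x k` abstracts the quadratic form of the out-neighbour with label `φ k` at the image of
    -- `x`. The first hypothesis on it is (Pull); the second is (Inh) combined with hyperbolicity of
    -- the out-neighbours.
    hyperbolic : Connected (λ k l → M (φ k) (φ l)) → (Φ : Vector Carrier d → Vector Carrier n) →
      (∀ x → ⟨ x , M · x ⟩ ≤ sum (λ k → h (φ k) * Φ x k)) →
      (∀ x k → Φ x k * (M · h) (φ k) ≤ (M · x) (φ k) * (M · x) (φ k)) →
      HyperbolicMatrix M
    hyperbolic connected Φ pull Φ-bound = nonPos-on-complement⇒hyperbolic M-sym h nonPos
      where
      C-connected : Connected C
      C-connected P i j Pi Pj C≈0 = connected P i j Pi Pj λ k l Pk Pl →
        *-cancelˡ-≈0 (h-pos l) (trans (*-comm (h (φ l)) (M (φ k) (φ l))) (*-cancelˡ-≈0 (h-pos k) (C≈0 k l Pk Pl)))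

      C-bound : ∀ u → ⟨ u , C · u ⟩ ≤ sum (λ k → e k * ((C · u) k * (C · u) k))
      C-bound u = begin
        ⟨ u , C · u ⟩                 ≈⟨ ⟨u,C·u⟩≈ {u} {x} u≈x ⟩
        ⟨ x , M · x ⟩                 ≤⟨ pull x ⟩
        sum (λ k → h (φ k) * Φ x k)   ≤⟨ sum-mono-≤ term ⟩
        sum (λ k → e k * ((C · u) k * (C · u) k)) ∎
        where
        x = lift u
        u≈x = represents-lift u

        term : ∀ k → h (φ k) * Φ x k ≤ e k * ((C · u) k * (C · u) k)
        term k = begin
          H * Φ x k
            ≈⟨ *-identityˡ _ ⟨
          1# * (H * Φ x k)
            -- Inserting `H * g * E`, which is 1 because `deg k` is `H * g`, creates the product
            -- `Φ x k * g` that `Φ-bound` controls.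
            ≈⟨ *-congʳ (trans (*-congʳ (sym (deg≈ k))) (deg*e≈1 k)) ⟨
          H * g * E * (H * Φ x k)
            ≈⟨ solve 4 (λ H g E f → H :* g :* E :* (H :* f) := E :* (H :* H) :* (f :* g)) refl H g E (Φ x k) ⟩
          E * (H * H) * (Φ x k * g)
            ≤⟨ *-monoˡ-≤ (*-nonNeg (proj₁ (proj₂ (inverse (deg-pos k)))) (0≤x*x H)) (Φ-bound x k) ⟩
          E * (H * H) * (μ * μ)
            ≈⟨ solve 3 (λ E H m → E :* (H :* H) :* (m :* m) := E :* (H :* m :* (H :* m))) refl E H μ ⟩
          E * (H * μ * (H * μ))
            ≈⟨ *-congˡ (*-cong (C·u≈ {u} {x} u≈x k) (C·u≈ {u} {x} u≈x k)) ⟨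
          E * ((C · u) k * (C · u) k) ∎
          where
          H = h (φ k)
          E = e k
          g = (M · h) (φ k)
          μ = (M · x) (φ k)

      nonPos : ∀ z → ⟨ h , M · z ⟩ ≈ 0# → ⟨ z , M · z ⟩ ≤ 0#
      nonPos z ⟨h,Mz⟩≈0 = ≤-respˡ-≈ (⟨u,C·u⟩≈ {u} {z} u≈z)
        (nonPos-on-complement e deg*e≈1 C-bound C-connected u (begin-equality
          sum (C · u)                            ≈⟨ sum-cong-≋ (C·u≈ {u} {z} u≈z) ⟩
          sum (λ k → h (φ k) * (M · z) (φ k))    ≈⟨ ⟨x,M·y⟩-reindex h z ⟨
          ⟨ h , M · z ⟩                          ≈⟨ ⟨h,Mz⟩≈0 ⟩
          0#                                     ∎))
        where
        u : Vector Carrier n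
        u k = proj₁ (inverse (h-pos k)) * z (φ k)

        u≈z : u Represents z
        u≈z k = begin-equality
          z (φ k)                                            ≈⟨ *-identityˡ _ ⟨
          1# * z (φ k)                                       ≈⟨ *-congʳ (proj₂ (proj₂ (inverse (h-pos k)))) ⟨
          h (φ k) * proj₁ (inverse (h-pos k)) * z (φ k)      ≈⟨ *-assoc _ _ _ ⟩
          h (φ k) * u k                                      ∎

-- The Cauchy reals as an ordered field

module RealField where
  open Defs using (_≈_; _≤_; _<_; _+_; _*_; 0ℝ)
  open ℚ.≤-Reasoning

  private
    half+half : ∀ ε → ½ ℚ.* ε ℚ.+ ½ ℚ.* ε ≡ ε
    half+half ε = ≡.trans (≡.sym (ℚ.*-distribʳ-+ ε ½ ½)) (ℚ.*-identityˡ ε)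

    half-pos : ∀ ε → .{{Positive ε}} → Positive (½ ℚ.* ε)
    half-pos ε = ℚ.pos*pos⇒pos ½ ε

    0≤ : ∀ ε → .{{Positive ε}} → 0ℚ ℚ.≤ ε
    0≤ ε = ℚ.<⇒≤ (ℚ.positive⁻¹ ε)

    p≤∣p∣ : ∀ p → p ℚ.≤ ℚ.∣ p ∣
    p≤∣p∣ p with ℚ.≤-total 0ℚ p
    ... | inj₁ 0≤p = ℚ.≤-reflexive (≡.sym (ℚ.0≤p⇒∣p∣≡p 0≤p))
    ... | inj₂ p≤0 = ℚ.≤-trans p≤0 (ℚ.0≤∣p∣ p)

    ∣p-q∣≤ε⇒p≤q+ε : ∀ {p q ε} → ℚ.∣ p ℚ.- q ∣ ℚ.≤ ε → p ℚ.≤ q ℚ.+ ε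
    ∣p-q∣≤ε⇒p≤q+ε {p} {q} {ε} ∣p-q∣≤ε = begin
      p                        ≡⟨ split p q ⟩
      q ℚ.+ (p ℚ.- q)          ≤⟨ ℚ.+-monoʳ-≤ q (ℚ.≤-trans (p≤∣p∣ (p ℚ.- q)) ∣p-q∣≤ε) ⟩
      q ℚ.+ ε                  ∎
      where
      split : ∀ p q → p ≡ q ℚ.+ (p ℚ.- q)
      split = solve-∀ ℚ-ring

    p≤q+ε⇒p-q≤ε : ∀ {p q ε} → p ℚ.≤ q ℚ.+ ε → p ℚ.- q ℚ.≤ ε
    p≤q+ε⇒p-q≤ε {p} {q} {ε} p≤q+ε =
      ℚ.≤-trans (ℚ.+-monoˡ-≤ (ℚ.- q) p≤q+ε) (ℚ.≤-reflexive (cancel q ε))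
      where
      cancel : ∀ q ε → q ℚ.+ ε ℚ.- q ≡ ε
      cancel = solve-∀ ℚ-ring

    +-cancelʳ-≤ : ∀ r {p q} → p ℚ.+ r ℚ.≤ q ℚ.+ r → p ℚ.≤ q
    +-cancelʳ-≤ r {p} {q} p+r≤q+r = begin
      p               ≡⟨ cancel p r ⟨
      p ℚ.+ r ℚ.- r   ≤⟨ ℚ.+-monoˡ-≤ (ℚ.- r) p+r≤q+r ⟩
      q ℚ.+ r ℚ.- r   ≡⟨ cancel q r ⟩
      q               ∎
      where
      cancel : ∀ p r → p ℚ.+ r ℚ.- r ≡ p
      cancel = solve-∀ ℚ-ring

    ∣p-q∣≡∣q-p∣ : ∀ p q → ℚ.∣ p ℚ.- q ∣ ≡ ℚ.∣ q ℚ.- p ∣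
    ∣p-q∣≡∣q-p∣ p q = ≡.trans (cong ℚ.∣_∣ (flip p q)) (ℚ.∣-p∣≡∣p∣ (q ℚ.- p))
      where
      flip : ∀ p q → p ℚ.- q ≡ ℚ.- (q ℚ.- p)
      flip = solve-∀ ℚ-ring

    p≤q+ε⇒∣p-q∣≤ε : ∀ {p q ε} → p ℚ.≤ q ℚ.+ ε → q ℚ.≤ p ℚ.+ ε → ℚ.∣ p ℚ.- q ∣ ℚ.≤ ε
    p≤q+ε⇒∣p-q∣≤ε {p} {q} {ε} p≤q+ε q≤p+ε with ℚ.∣p∣≡p∨∣p∣≡-p (p ℚ.- q)
    ... | inj₁ eq = ℚ.≤-trans (ℚ.≤-reflexive eq) (p≤q+ε⇒p-q≤ε p≤q+ε)
    ... | inj₂ eq = ℚ.≤-trans (ℚ.≤-reflexive (≡.trans eq (flip p q))) (p≤q+ε⇒p-q≤ε q≤p+ε)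
      where
      flip : ∀ p q → ℚ.- (p ℚ.- q) ≡ q ℚ.- p
      flip = solve-∀ ℚ-ring

  ≈⇒≤ : ∀ {x y} → x ≈ y → x ≤ y
  ≈⇒≤ x≈y ε = let N , p = x≈y ε in N , λ n N≤n → ∣p-q∣≤ε⇒p≤q+ε (p n N≤n)

  ≤-antisym : ∀ {x y} → x ≤ y → y ≤ x → x ≈ y
  ≤-antisym x≤y y≤x ε =
    let M , p = x≤y ε
        N , q = y≤x ε
    in M ℕ.⊔ N , λ n M⊔N≤n →
      p≤q+ε⇒∣p-q∣≤ε (p n (ℕ.m⊔n≤o⇒m≤o M N M⊔N≤n)) (q n (ℕ.m⊔n≤o⇒n≤o M N M⊔N≤n))

  ≤-trans : ∀ {x y z} → x ≤ y → y ≤ z → x ≤ z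
  ≤-trans {x} {y} {z} x≤y y≤z ε =
    let M , p = x≤y (½ ℚ.* ε) {{half-pos ε}}
        N , q = y≤z (½ ℚ.* ε) {{half-pos ε}}
    in M ℕ.⊔ N , λ n M⊔N≤n → begin
      seq x n
        ≤⟨ p n (ℕ.m⊔n≤o⇒m≤o M N M⊔N≤n) ⟩
      seq y n ℚ.+ ½ ℚ.* ε
        ≤⟨ ℚ.+-monoˡ-≤ (½ ℚ.* ε) (q n (ℕ.m⊔n≤o⇒n≤o M N M⊔N≤n)) ⟩
      seq z n ℚ.+ ½ ℚ.* ε ℚ.+ ½ ℚ.* ε
        ≡⟨ ℚ.+-assoc (seq z n) (½ ℚ.* ε) (½ ℚ.* ε) ⟩
      seq z n ℚ.+ (½ ℚ.* ε ℚ.+ ½ ℚ.* ε)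
        ≡⟨ cong (seq z n ℚ.+_) (half+half ε) ⟩
      seq z n ℚ.+ ε ∎

  pointwise : ∀ {x y} → (∀ n → seq x n ≡ seq y n) → x ≈ y
  pointwise {x} {y} x≡y ε = 0 , λ n _ → begin
    ℚ.∣ seq x n ℚ.- seq y n ∣ ≡⟨ cong (λ z → ℚ.∣ z ℚ.- seq y n ∣) (x≡y n) ⟩
    ℚ.∣ seq y n ℚ.- seq y n ∣ ≡⟨ cong ℚ.∣_∣ (ℚ.+-inverseʳ (seq y n)) ⟩
    0ℚ                        ≤⟨ 0≤ ε ⟩
    ε                         ∎

  ≈-refl : ∀ {x} → x ≈ x
  ≈-refl {x} = pointwise {x} {x} λ _ → ≡.refl

  ≈-sym : ∀ {x y} → x ≈ y → y ≈ x
  ≈-sym {x} {y} x≈y ε = let N , p = x≈y ε in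
    N , λ n N≤n → subst (ℚ._≤ ε) (∣p-q∣≡∣q-p∣ (seq x n) (seq y n)) (p n N≤n)

  ≈-trans : ∀ {x y z} → x ≈ y → y ≈ z → x ≈ z
  ≈-trans {x} {y} {z} x≈y y≈z = ≤-antisym {x} {z}
    (≤-trans {x} {y} {z} (≈⇒≤ {x} {y} x≈y) (≈⇒≤ {y} {z} y≈z))
    (≤-trans {z} {y} {x} (≈⇒≤ {z} {y} (≈-sym {y} {z} y≈z)) (≈⇒≤ {y} {x} (≈-sym {x} {y} x≈y)))

  +-monoˡ-≤ : ∀ {x y} z → x ≤ y → x + z ≤ y + z
  +-monoˡ-≤ {x} {y} z x≤y ε = let N , p = x≤y ε in N , λ n N≤n → begin
    seq x n ℚ.+ seq z n           ≤⟨ ℚ.+-monoˡ-≤ (seq z n) (p n N≤n) ⟩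
    seq y n ℚ.+ ε ℚ.+ seq z n     ≡⟨ swap (seq y n) ε (seq z n) ⟩
    seq y n ℚ.+ seq z n ℚ.+ ε     ∎
    where
    swap : ∀ y ε z → y ℚ.+ ε ℚ.+ z ≡ y ℚ.+ z ℚ.+ ε
    swap = solve-∀ ℚ-ring

  +-comm : ∀ x y → x + y ≈ y + x
  +-comm x y = pointwise {x + y} {y + x} λ n → ℚ.+-comm (seq x n) (seq y n)

  *-comm : ∀ x y → x * y ≈ y * x
  *-comm x y = pointwise {x * y} {y * x} λ n → ℚ.*-comm (seq x n) (seq y n)

  +-congʳ : ∀ {x y} z → x ≈ y → x + z ≈ y + z
  +-congʳ {x} {y} z x≈y = ≤-antisym {x + z} {y + z}
    (+-monoˡ-≤ {x} {y} z (≈⇒≤ {x} {y} x≈y))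
    (+-monoˡ-≤ {y} {x} z (≈⇒≤ {y} {x} (≈-sym {x} {y} x≈y)))

  +-cong : ∀ {w x y z} → w ≈ x → y ≈ z → w + y ≈ x + z
  +-cong {w} {x} {y} {z} w≈x y≈z = ≈-trans {w + y} {x + y} {x + z} (+-congʳ {w} {x} y w≈x)
    (≈-trans {x + y} {y + x} {x + z} (+-comm x y)
      (≈-trans {y + x} {z + x} {x + z} (+-congʳ {y} {z} x y≈z) (+-comm z x)))

  *-cong : ∀ {w x y z} → w ≈ x → y ≈ z → w * y ≈ x * z
  *-cong {w} {x} {y} {z} w≈x y≈z ε =
    let B , B-pos , I , ∣w∣≤B = cauchy⇒eventually-bounded {seq w} (cauchy w)
        C , C-pos , J , ∣z∣≤C = cauchy⇒eventually-bounded {seq z} (cauchy z)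
        δ , δ-pos , δ[B+C]≡ε = ∃-divisor ε (B ℚ.+ C) {{ℚ.pos+pos⇒pos B {{B-pos}} C {{C-pos}}}}
        M , p = w≈x δ {{δ-pos}}
        N , q = y≈z δ {{δ-pos}}
    in (I ℕ.⊔ J) ℕ.⊔ (M ℕ.⊔ N) , λ n ≤n →
      let I⊔J≤n = ℕ.m⊔n≤o⇒m≤o (I ℕ.⊔ J) (M ℕ.⊔ N) ≤n
          M⊔N≤n = ℕ.m⊔n≤o⇒n≤o (I ℕ.⊔ J) (M ℕ.⊔ N) ≤n
      in ℚ.≤-trans
        (∣ab-cd∣≤ {seq w n} {seq y n} {seq x n} {seq z n} {B} {C} {δ} (0≤ B {{B-pos}}) (0≤ δ {{δ-pos}})
          (∣w∣≤B n (ℕ.m⊔n≤o⇒m≤o I J I⊔J≤n)) (∣z∣≤C n (ℕ.m⊔n≤o⇒n≤o I J I⊔J≤n))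
          (p n (ℕ.m⊔n≤o⇒m≤o M N M⊔N≤n)) (q n (ℕ.m⊔n≤o⇒n≤o M N M⊔N≤n)))
        (ℚ.≤-reflexive δ[B+C]≡ε)

  private
    ∣-p--q∣≡∣p-q∣ : ∀ p q → ℚ.∣ ℚ.- p ℚ.- (ℚ.- q) ∣ ≡ ℚ.∣ p ℚ.- q ∣
    ∣-p--q∣≡∣p-q∣ p q = ≡.trans (cong ℚ.∣_∣ (flip p q)) (ℚ.∣-p∣≡∣p∣ (p ℚ.- q))
      where
      flip : ∀ p q → ℚ.- p ℚ.- (ℚ.- q) ≡ ℚ.- (p ℚ.- q)
      flip = solve-∀ ℚ-ring

  -_ : ℝ → ℝ
  - x = mkℝ (λ n → ℚ.- seq x n) λ ε → let N , p = cauchy x ε in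
    N , λ m n N≤m N≤n → subst (ℚ._≤ ε) (≡.sym (∣-p--q∣≡∣p-q∣ (seq x m) (seq x n))) (p m n N≤m N≤n)

  -‿cong : ∀ {x y} → x ≈ y → - x ≈ - y
  -‿cong {x} {y} x≈y ε = let N , p = x≈y ε in
    N , λ n N≤n → subst (ℚ._≤ ε) (≡.sym (∣-p--q∣≡∣p-q∣ (seq x n) (seq y n))) (p n N≤n)

  constant : ℚ → ℝ
  constant q = mkℝ (λ _ → q) (const-cauchy q)

  isCommutativeRing : IsCommutativeRing _≈_ _+_ _*_ -_ 0ℝ (constant 1ℚ)
  isCommutativeRing = record
    { isRing = record
      { +-isAbelianGroup = record
        { isGroup = record
          { isMonoid = record
            { isSemigroup = record
              { isMagma = record
                { isEquivalence = record
                  { refl  = λ {x} → ≈-refl {x}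
                  ; sym   = λ {x} {y} → ≈-sym {x} {y}
                  ; trans = λ {x} {y} {z} → ≈-trans {x} {y} {z}
                  }
                ; ∙-cong = λ {w} {x} {y} {z} → +-cong {w} {x} {y} {z}
                }
              ; assoc = λ x y z → pointwise {x + y + z} {x + (y + z)}
                  λ n → ℚ.+-assoc (seq x n) (seq y n) (seq z n)
              }
            ; identity = (λ x → pointwise {0ℝ + x} {x} λ n → ℚ.+-identityˡ (seq x n))
                       , (λ x → pointwise {x + 0ℝ} {x} λ n → ℚ.+-identityʳ (seq x n))
            }
          ; inverse = (λ x → pointwise { - x + x } {0ℝ} λ n → ℚ.+-inverseˡ (seq x n))
                    , (λ x → pointwise {x + - x} {0ℝ} λ n → ℚ.+-inverseʳ (seq x n))
          ; ⁻¹-cong = λ {x} {y} → -‿cong {x} {y}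
          }
        ; comm = +-comm
        }
      ; *-cong = λ {w} {x} {y} {z} → *-cong {w} {x} {y} {z}
      ; *-assoc = λ x y z → pointwise {x * y * z} {x * (y * z)}
          λ n → ℚ.*-assoc (seq x n) (seq y n) (seq z n)
      ; *-identity = (λ x → pointwise {constant 1ℚ * x} {x} λ n → ℚ.*-identityˡ (seq x n))
                   , (λ x → pointwise {x * constant 1ℚ} {x} λ n → ℚ.*-identityʳ (seq x n))
      ; distrib = (λ x y z → pointwise {x * (y + z)} {x * y + x * z}
                     λ n → ℚ.*-distribˡ-+ (seq x n) (seq y n) (seq z n))
                , (λ x y z → pointwise {(y + z) * x} {y * x + z * x}
                     λ n → ℚ.*-distribʳ-+ (seq x n) (seq y n) (seq z n))
      }
    ; *-comm = *-comm
    }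

  <⇒≤ : ∀ {x y} → x < y → x ≤ y
  <⇒≤ {x} {y} (η , η-pos , N , p) ε = N , λ n N≤n → begin
    seq x n         ≡⟨ ℚ.+-identityʳ (seq x n) ⟨
    seq x n ℚ.+ 0ℚ  ≤⟨ ℚ.+-monoʳ-≤ (seq x n) (0≤ η {{η-pos}}) ⟩
    seq x n ℚ.+ η   ≤⟨ p n N≤n ⟩
    seq y n         ≡⟨ ℚ.+-identityʳ (seq y n) ⟨
    seq y n ℚ.+ 0ℚ  ≤⟨ ℚ.+-monoʳ-≤ (seq y n) (0≤ ε) ⟩
    seq y n ℚ.+ ε   ∎

  <-≤-trans : ∀ {x y z} → x < y → y ≤ z → x < z
  <-≤-trans {x} {y} {z} (η , η-pos , M , p) y≤z =
    let N , q = y≤z (½ ℚ.* η) {{half-pos η {{η-pos}}}}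
    in ½ ℚ.* η , half-pos η {{η-pos}} , M ℕ.⊔ N , λ n M⊔N≤n → +-cancelʳ-≤ (½ ℚ.* η) (begin
      seq x n ℚ.+ ½ ℚ.* η ℚ.+ ½ ℚ.* η   ≡⟨ ℚ.+-assoc (seq x n) (½ ℚ.* η) (½ ℚ.* η) ⟩
      seq x n ℚ.+ (½ ℚ.* η ℚ.+ ½ ℚ.* η) ≡⟨ cong (seq x n ℚ.+_) (half+half η) ⟩
      seq x n ℚ.+ η                     ≤⟨ p n (ℕ.m⊔n≤o⇒m≤o M N M⊔N≤n) ⟩
      seq y n                           ≤⟨ q n (ℕ.m⊔n≤o⇒n≤o M N M⊔N≤n) ⟩
      seq z n ℚ.+ ½ ℚ.* η               ∎)

  <-irrefl : ∀ {x} → ¬ (x < x)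
  <-irrefl {x} (η , η-pos , N , p) = ℚ.<-irrefl ≡.refl (ℚ.<-≤-trans
    (subst (ℚ._< seq x N ℚ.+ η) (ℚ.+-identityʳ (seq x N))
      (ℚ.+-monoʳ-< (seq x N) (ℚ.positive⁻¹ η {{η-pos}})))
    (p N ℕ.≤-refl))

  -- Comparing the sequences at one late index, up to 3δ where ε = 5δ, decides
  -- between y ≤ x + ε and x < y.
  ≮⇒≥ : ∀ {x y} → ¬ (x < y) → y ≤ x
  ≮⇒≥ {x} {y} x≮y ε =
    let δ , δ-pos , δ*5≡ε = ∃-divisor ε five
        M , p = cauchy x δ {{δ-pos}}
        N , q = cauchy y δ {{δ-pos}}
    in M ℕ.⊔ N , compare δ δ-pos δ*5≡ε (M ℕ.⊔ N)
      (λ m n M⊔N≤m M⊔N≤n → ∣p-q∣≤ε⇒p≤q+ε (p m n (ℕ.m⊔n≤o⇒m≤o M N M⊔N≤m) (ℕ.m⊔n≤o⇒m≤o M N M⊔N≤n)))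
      (λ m n M⊔N≤m M⊔N≤n → ∣p-q∣≤ε⇒p≤q+ε (q m n (ℕ.m⊔n≤o⇒n≤o M N M⊔N≤m) (ℕ.m⊔n≤o⇒n≤o M N M⊔N≤n)))
    where
    five = 1ℚ ℚ.+ 1ℚ ℚ.+ 1ℚ ℚ.+ 1ℚ ℚ.+ 1ℚ

    sum₅ : ∀ x δ → x ℚ.+ δ ℚ.+ (δ ℚ.+ δ ℚ.+ δ) ℚ.+ δ ≡ x ℚ.+ δ ℚ.* (1ℚ ℚ.+ 1ℚ ℚ.+ 1ℚ ℚ.+ 1ℚ ℚ.+ 1ℚ)
    sum₅ = solve-∀ ℚ-ring

    sum₃ : ∀ x δ → x ℚ.+ δ ℚ.+ δ ℚ.+ δ ≡ x ℚ.+ (δ ℚ.+ δ ℚ.+ δ)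
    sum₃ = solve-∀ ℚ-ring

    compare : ∀ δ → Positive δ → δ ℚ.* five ≡ ε → ∀ K →
      (∀ m n → K ℕ.≤ m → K ℕ.≤ n → seq x m ℚ.≤ seq x n ℚ.+ δ) →
      (∀ m n → K ℕ.≤ m → K ℕ.≤ n → seq y m ℚ.≤ seq y n ℚ.+ δ) →
      ∀ n → K ℕ.≤ n → seq y n ℚ.≤ seq x n ℚ.+ ε
    compare δ δ-pos δ*5≡ε K p q n K≤n with seq y K ℚ.≤? seq x K ℚ.+ (δ ℚ.+ δ ℚ.+ δ)
    ... | yes yK≤ = begin
      seq y n                                         ≤⟨ q n K K≤n ℕ.≤-refl ⟩
      seq y K ℚ.+ δ                                   ≤⟨ ℚ.+-monoˡ-≤ δ yK≤ ⟩
      seq x K ℚ.+ (δ ℚ.+ δ ℚ.+ δ) ℚ.+ δ               ≤⟨ ℚ.+-monoˡ-≤ δ (ℚ.+-monoˡ-≤ (δ ℚ.+ δ ℚ.+ δ) (p K n ℕ.≤-refl K≤n)) ⟩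
      seq x n ℚ.+ δ ℚ.+ (δ ℚ.+ δ ℚ.+ δ) ℚ.+ δ         ≡⟨ sum₅ (seq x n) δ ⟩
      seq x n ℚ.+ δ ℚ.* five                          ≡⟨ cong (seq x n ℚ.+_) δ*5≡ε ⟩
      seq x n ℚ.+ ε                                   ∎
    ... | no yK≰ = contradiction (δ , δ-pos , K , λ m K≤m → +-cancelʳ-≤ δ (begin
      seq x m ℚ.+ δ ℚ.+ δ           ≤⟨ ℚ.+-monoˡ-≤ δ (ℚ.+-monoˡ-≤ δ (p m K K≤m ℕ.≤-refl)) ⟩
      seq x K ℚ.+ δ ℚ.+ δ ℚ.+ δ     ≡⟨ sum₃ (seq x K) δ ⟩
      seq x K ℚ.+ (δ ℚ.+ δ ℚ.+ δ)   <⟨ ℚ.≰⇒> yK≰ ⟩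
      seq y K                       ≤⟨ q K m ℕ.≤-refl K≤m ⟩
      seq y m ℚ.+ δ                 ∎)) x≮y

  *-pos : ∀ {x y} → 0ℝ < x → 0ℝ < y → 0ℝ < x * y
  *-pos {x} {y} (η , η-pos , M , p) (ζ , ζ-pos , N , q) =
    η ℚ.* ζ , ℚ.pos*pos⇒pos η {{η-pos}} ζ {{ζ-pos}} , M ℕ.⊔ N , λ n M⊔N≤n →
      let η≤x = ℚ.≤-trans (ℚ.≤-reflexive (≡.sym (ℚ.+-identityˡ η))) (p n (ℕ.m⊔n≤o⇒m≤o M N M⊔N≤n))
          ζ≤y = ℚ.≤-trans (ℚ.≤-reflexive (≡.sym (ℚ.+-identityˡ ζ))) (q n (ℕ.m⊔n≤o⇒n≤o M N M⊔N≤n))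
      in ℚ.≤-trans (ℚ.≤-reflexive (ℚ.+-identityˡ (η ℚ.* ζ)))
        (Defs.*-mono-≤ (0≤ ζ {{ζ-pos}}) (ℚ.≤-trans (0≤ η {{η-pos}}) η≤x) η≤x ζ≤y)

  inverse : ∀ {x} → 0ℝ < x → ∃[ y ] 0ℝ ≤ y × x * y ≈ constant 1ℚ
  inverse {x} (η , η-pos , N , 0+η≤x) = mkℝ inv inv-cauchy
    , (λ ε → 0 , λ n _ → ℚ.≤-trans (inv-nonNeg n)
        (ℚ.≤-trans (ℚ.≤-reflexive (≡.sym (ℚ.+-identityʳ (inv n)))) (ℚ.+-monoʳ-≤ (inv n) (0≤ ε))))
    , λ ε → N , λ n N≤n → ℚ.≤-trans
        (ℚ.≤-reflexive (≡.trans (cong (λ z → ℚ.∣ z ℚ.- 1ℚ ∣) (x*inv≡1 n N≤n)) (cong ℚ.∣_∣ (ℚ.+-inverseʳ 1ℚ))))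
        (0≤ ε)
    where
    instance
      _ = η-pos
      _ = ℚ.pos⇒nonZero η

    η≤x : ∀ n → N ℕ.≤ n → η ℚ.≤ seq x n
    η≤x n N≤n = ℚ.≤-trans (ℚ.≤-reflexive (≡.sym (ℚ.+-identityˡ η))) (0+η≤x n N≤n)

    max-pos : ∀ n → Positive (seq x n ℚ.⊔ η)
    max-pos n = ℚ.positive (ℚ.<-≤-trans (ℚ.positive⁻¹ η) (ℚ.p≤q⊔p (seq x n) η))

    -- The maximum with `η` keeps the early terms invertible, where nothing is known about `x`; from
    -- `N` on it equals `seq x n`.
    inv : ℕ → ℚ
    inv n = (ℚ.1/ (seq x n ℚ.⊔ η)) {{ℚ.pos⇒nonZero (seq x n ℚ.⊔ η) {{max-pos n}}}}

    inv-nonNeg : ∀ n → 0ℚ ℚ.≤ inv n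
    inv-nonNeg n = 0≤ (inv n) {{ℚ.1/pos⇒pos (seq x n ℚ.⊔ η) {{max-pos n}}}}

    x*inv≡1 : ∀ n → N ℕ.≤ n → seq x n ℚ.* inv n ≡ 1ℚ
    x*inv≡1 n N≤n = ≡.trans (cong (ℚ._* inv n) (≡.sym (ℚ.p≥q⇒p⊔q≡p (η≤x n N≤n))))
      (ℚ.*-inverseʳ (seq x n ℚ.⊔ η) {{ℚ.pos⇒nonZero (seq x n ℚ.⊔ η) {{max-pos n}}}})

    c = ℚ.1/ η

    instance
      c-pos : Positive c
      c-pos = ℚ.1/pos⇒pos η

    inv≤c : ∀ n → N ℕ.≤ n → inv n ℚ.≤ c
    inv≤c n N≤n = begin
      inv n                       ≡⟨ ℚ.*-identityˡ (inv n) ⟨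
      1ℚ ℚ.* inv n                ≡⟨ cong (ℚ._* inv n) (ℚ.*-inverseˡ η) ⟨
      c ℚ.* η ℚ.* inv n           ≡⟨ ℚ.*-assoc c η (inv n) ⟩
      c ℚ.* (η ℚ.* inv n)         ≤⟨ ℚ.*-monoˡ-≤-nonNeg c {{ℚ.pos⇒nonNeg c}}
                                       (ℚ.*-monoʳ-≤-nonNeg (inv n) {{ℚ.nonNegative (inv-nonNeg n)}} (η≤x n N≤n)) ⟩
      c ℚ.* (seq x n ℚ.* inv n)   ≡⟨ cong (c ℚ.*_) (x*inv≡1 n N≤n) ⟩
      c ℚ.* 1ℚ                    ≡⟨ ℚ.*-identityʳ c ⟩
      c                           ∎

    factor : ∀ a b i j → i ℚ.* (b ℚ.* j) ℚ.- (a ℚ.* i) ℚ.* j ≡ i ℚ.* j ℚ.* (b ℚ.- a)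
    factor = solve-∀ ℚ-ring

    -- Rests on 1/a - 1/b = (b - a)/(ab), written in `factor` with `i` and `j` for the reciprocals.
    -- Both are at most `c`, the inverse of `η`, so `δ` is chosen with `δ * (c * c)` equal to `ε`.
    inv-cauchy : IsCauchy inv
    inv-cauchy ε =
      let δ , δ-pos , δ*cc≡ε = ∃-divisor ε (c ℚ.* c) {{ℚ.pos*pos⇒pos c c}}
          K , p = cauchy x δ {{δ-pos}}
      in N ℕ.⊔ K , λ m n ≤m ≤n →
        let N≤m = ℕ.m⊔n≤o⇒m≤o N K ≤m
            N≤n = ℕ.m⊔n≤o⇒m≤o N K ≤n
            i = inv m
            j = inv n
            0≤ij = ℚ.≤-trans (ℚ.≤-reflexive (≡.sym (ℚ.*-zeroʳ 0ℚ)))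
                     (Defs.*-mono-≤ ℚ.≤-refl (inv-nonNeg m) (inv-nonNeg m) (inv-nonNeg n))
        in begin
          ℚ.∣ i ℚ.- j ∣
            ≡⟨ cong₂ (λ s t → ℚ.∣ s ℚ.- t ∣) (ℚ.*-identityʳ i) (ℚ.*-identityˡ j) ⟨
          ℚ.∣ i ℚ.* 1ℚ ℚ.- 1ℚ ℚ.* j ∣
            ≡⟨ cong₂ (λ s t → ℚ.∣ i ℚ.* s ℚ.- t ℚ.* j ∣) (x*inv≡1 n N≤n) (x*inv≡1 m N≤m) ⟨
          ℚ.∣ i ℚ.* (seq x n ℚ.* j) ℚ.- (seq x m ℚ.* i) ℚ.* j ∣
            ≡⟨ cong ℚ.∣_∣ (factor (seq x m) (seq x n) i j) ⟩
          ℚ.∣ i ℚ.* j ℚ.* (seq x n ℚ.- seq x m) ∣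
            ≡⟨ ℚ.∣p*q∣≡∣p∣*∣q∣ (i ℚ.* j) (seq x n ℚ.- seq x m) ⟩
          ℚ.∣ i ℚ.* j ∣ ℚ.* ℚ.∣ seq x n ℚ.- seq x m ∣
            ≡⟨ cong (ℚ._* ℚ.∣ seq x n ℚ.- seq x m ∣) (ℚ.0≤p⇒∣p∣≡p 0≤ij) ⟩
          i ℚ.* j ℚ.* ℚ.∣ seq x n ℚ.- seq x m ∣
            ≤⟨ Defs.*-mono-≤ (ℚ.0≤∣p∣ (seq x n ℚ.- seq x m)) (0≤ (c ℚ.* c) {{ℚ.pos*pos⇒pos c c}})
                 (Defs.*-mono-≤ (inv-nonNeg n) (0≤ c) (inv≤c m N≤m) (inv≤c n N≤n))
                 (p n m (ℕ.m⊔n≤o⇒n≤o N K ≤n) (ℕ.m⊔n≤o⇒n≤o N K ≤m)) ⟩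
          c ℚ.* c ℚ.* δ
            ≡⟨ ℚ.*-comm (c ℚ.* c) δ ⟩
          δ ℚ.* (c ℚ.* c)
            ≡⟨ δ*cc≡ε ⟩
          ε ∎

  orderedField : OrderedField
  orderedField = record
    { commutativeRing = record { isCommutativeRing = isCommutativeRing }
    ; fromℚ = record
      { ⟦_⟧    = constant
      ; +-homo = λ p q → ≈-refl {constant (p ℚ.+ q)}
      ; *-homo = λ p q → ≈-refl {constant (p ℚ.* q)}
      ; -‿homo = λ p → ≈-refl {constant (ℚ.- p)}
      ; 0-homo = ≈-refl {0ℝ}
      ; 1-homo = ≈-refl {constant 1ℚ}
      }
    ; _≤_ = _≤_
    ; _<_ = _<_
    ; isPartialOrder = record
      { isPreorder = record
        { isEquivalence = IsCommutativeRing.isEquivalence isCommutativeRing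
        ; reflexive     = λ {x} {y} → ≈⇒≤ {x} {y}
        ; trans         = λ {x} {y} {z} → ≤-trans {x} {y} {z}
        }
      ; antisym = λ {x} {y} → ≤-antisym {x} {y}
      }
    ; +-monoˡ-≤ = λ {x} {y} → +-monoˡ-≤ {x} {y}
    ; <⇒≤       = λ {x} {y} → <⇒≤ {x} {y}
    ; <⇒≱       = λ {x} {y} x<y y≤x → <-irrefl {x} (<-≤-trans {x} {y} {x} x<y y≤x)
    ; ≮⇒≥       = λ {x} {y} → ≮⇒≥ {x} {y}
    ; <-≤-trans = λ {x} {y} {z} → <-≤-trans {x} {y} {z}
    ; *-pos     = λ {x} {y} → *-pos {x} {y}
    ; inverse   = λ {x} → inverse {x}
    }

-- Supports, irreducibility and atlases

open OrderedFieldProperties RealField.orderedField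
open LinearAlgebra RealField.orderedField

-- Blocks must consist of consecutive indices, so the indices are sorted with `false` before `true`.
-- Inductively the head stays in front or, through `insert`, moves to the last position.
sorting-permutation : ∀ {n} (P : Fin n → Bool) → Σ[ π ∈ Permutation′ n ]
  (∀ i j → i Fin.≤ j → P (π ⟨$⟩ʳ i) ≡ true → P (π ⟨$⟩ʳ j) ≡ true)
sorting-permutation {zero}  P = Perm.id , λ ()
sorting-permutation {suc n} P with sorting-permutation (P ∘ suc) | P zero in P0
... | π , π-mono | false = lift₀ π , mono
  where
  mono : ∀ i j → i Fin.≤ j → P (lift₀ π ⟨$⟩ʳ i) ≡ true → P (lift₀ π ⟨$⟩ʳ j) ≡ true
  mono zero    j       i≤j       Pi = contradiction (≡.trans (≡.sym P0) Pi) λ ()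
  mono (suc i) (suc j) (s≤s i≤j) Pi = π-mono i j i≤j Pi
... | π , π-mono | true = insert (fromℕ n) zero π , mono
  where
  mono : ∀ i j → i Fin.≤ j → P (insert (fromℕ n) zero π ⟨$⟩ʳ i) ≡ true → P (insert (fromℕ n) zero π ⟨$⟩ʳ j) ≡ true
  mono i j i≤j Pi with fromℕ n Fin.≟ j
  ... | yes _ = P0
  ... | no n≢j with fromℕ n Fin.≟ i
  ...   | yes ≡.refl = contradiction (Fin.≤-antisym i≤j (Fin.≤fromℕ j)) n≢j
  ...   | no n≢i = π-mono (punchOut n≢i) (punchOut n≢j) (Fin.punchOut-mono-≤ n≢i n≢j i≤j) Pi

-- With the `false` side of an uncrossed cut sorted first, the vanishing entries from the `true`
-- side to the `false` side form the lower left block, so the matrix splits into two blocks. The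
-- vertices `i` and `j` make both nonempty.
irreducible⇒connected : ∀ {n} {A : Matrix n} → Irreducible A → Connected A
irreducible⇒connected {n} {A} irreducible P i j Pi Pj A≈0 = irreducible
  ((λ k l → A (π ⟨$⟩ʳ k) (π ⟨$⟩ʳ l)) , 2 , s≤s (s≤s z≤n) , (π , λ k l → refl {A (π ⟨$⟩ʳ k) (π ⟨$⟩ʳ l)}) , record
    { block      = block
    ; monotone   = monotone
    ; surjective = surjective
    ; zeros      = zeros
    })
  where
  π = proj₁ (sorting-permutation P)

  number : Bool → Fin 2
  number b = if b then suc zero else zero

  block : Fin n → Fin 2
  block k = number (P (π ⟨$⟩ʳ k))

  monotone : ∀ {k l} → k Fin.≤ l → block k Fin.≤ block l
  monotone {k} {l} k≤l with P (π ⟨$⟩ʳ k) in Pk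
  ... | false = z≤n
  ... | true rewrite proj₂ (sorting-permutation P) k l k≤l Pk = s≤s z≤n

  surjective : ∀ b → ∃[ k ] (∀ {l} → l ≡ k → block l ≡ b)
  surjective zero       = π ⟨$⟩ˡ j , λ { ≡.refl → cong number (≡.trans (cong P (Perm.inverseʳ π)) Pj) }
  surjective (suc zero) = π ⟨$⟩ˡ i , λ { ≡.refl → cong number (≡.trans (cong P (Perm.inverseʳ π)) Pi) }

  zeros : ∀ k l → block l Fin.< block k → A (π ⟨$⟩ʳ k) (π ⟨$⟩ʳ l) ≈ 0#
  zeros k l bl<bk with P (π ⟨$⟩ʳ k) in Pk | P (π ⟨$⟩ʳ l) in Pl
  ... | true | false = A≈0 (π ⟨$⟩ʳ k) (π ⟨$⟩ʳ l) Pk Pl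
  zeros k l (s≤s ()) | true | true
  zeros k l ()       | false | _

lookup-injective : ∀ {a} {A : Set a} {xs : List A} → Unique xs → Injective _≡_ _≡_ (lookup xs)
lookup-injective (x∉xs ∷ xs!) {zero}  {zero}  eq = ≡.refl
lookup-injective (x∉xs ∷ xs!) {zero}  {suc j} eq = contradiction eq (All.lookup x∉xs (∈-lookup j))
lookup-injective (x∉xs ∷ xs!) {suc i} {zero}  eq = contradiction (≡.sym eq) (All.lookup x∉xs (∈-lookup i))
lookup-injective (x∉xs ∷ xs!) {suc i} {suc j} eq = cong suc (lookup-injective xs! eq)

enumerate-support : ∀ {d} {M : Matrix d} → (∀ i → Dec (Supp M i)) → SuppEnumeration M
enumerate-support {d} supp? = record
  { size      = length support
  ; index     = lookup support
  ; injective = lookup-injective (filter⁺ supp? (allFin⁺ d))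
  ; range     = λ i → mk⇔
      (λ i∈supp → let i∈ = ∈-filter⁺ supp? (∈-allFin i) i∈supp in index i∈ , ≡.sym (lookup-index i∈))
      (λ { (k , ≡.refl) → proj₂ (∈-filter⁻ supp? {xs = allFin d} (∈-lookup k)) })
  }
  where support = filter supp? (allFin d)

theorem5p2 : {a ℓ : Level} {d : ℕ} (𝔸 : Atlas a ℓ d) → let open Atlas 𝔸 in
    Inh → Pull →
    (v : Ω⁺) → Regular v →
    (∀ w → vertex v ⟶ w → Hyperbolic w) →
    Hyperbolic (vertex v)
theorem5p2 {d = d} 𝔸 inh pull v (irreducible , h-pos) hyperbolic-next x y 0<⟨y,My⟩ =
  ≤-stable {⟨ x , A · x ⟩ * ⟨ y , A · y ⟩} {⟨ x , A · y ⟩ * ⟨ x , A · y ⟩} λ k →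
  -- Deciding the support at each of the finitely many labels yields the listing over which (Pull)
  -- and regularity are stated.
  ¬¬-sequence {P = λ i → Dec (Supp A i)} (λ _ → ¬¬-excluded-middle) λ supp? →
  let E = enumerate-support {M = A} supp? in
  ¬¬-sequence (λ k → Ah-pos (in-support E k)) λ Ah-pos →
  k (hyperbolic E Ah-pos x y 0<⟨y,My⟩)
  where
  open Atlas 𝔸

  A : Matrix d
  A = M (vertex v)

  g : Vector ℝ d
  g = h (vertex v)

  -- A nonzero entry `A i j` is positive up to double negation. By symmetry `j` lies in the support
  -- too, so `g j` is positive, and the remaining terms of the row are nonnegative.
  Ah-pos : ∀ {i} → Supp A i → ¬ ¬ (0# < (A · g) i)
  Ah-pos {i} (j , Aij≉0) k = 0<x⊎x≤0 (A i j) λ where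
    (inj₂ Aij≤0) → Aij≉0 (antisym {A i j} {0#} Aij≤0 (M-nonNeg (vertex v) i j))
    (inj₁ 0<Aij) → k (<-≤-trans {0#} {A i j * g j} {(A · g) i}
      (*-pos {A i j} {g j} 0<Aij
        (h-pos j (i , λ Aji≈0 → Aij≉0 (trans {A i j} {A j i} {0#} (M-symmetric (vertex v) i j) Aji≈0))))
      (term≤sum (λ j → A i j * g j) (λ j → *-nonNeg {A i j} {g j} (M-nonNeg (vertex v) i j) (h-nonNeg (vertex v) j)) j))

  module _ (E : SuppEnumeration A) where
    open SuppEnumeration E using () renaming (index to φ; injective to φ-injective; range to φ-range)

    in-support : ∀ k → Supp A (φ k)
    in-support k = Equivalence.from (φ-range (φ k)) (k , ≡.refl)

    A≈0-off-support : ∀ i → (∀ k → ¬ (φ k ≡ i)) → ∀ j → A i j ≈ 0#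
    A≈0-off-support i i∉φ j = ≈-stable {A i j} {0#} λ Aij≉0 →
      let k , φk≡i = Equivalence.to (φ-range i) (j , Aij≉0) in i∉φ k φk≡i

    Φ : Vector ℝ d → Fin (SuppEnumeration.size E) → ℝ
    Φ x k = ⟨ T v (φ k) x , M (next v (φ k)) · T v (φ k) x ⟩

    -- Hyperbolicity of the out-neighbour at the pair `Tx`, `Tg`. By (Inh) at `g`, the form at `Tg`
    -- is `(A · g) i`, whose positivity is the premise that hyperbolicity demands; (Inh) at `x`
    -- evaluates the mixed term.
    Φ-bound : (∀ k → 0# < (A · g) (φ k)) →
      ∀ x k → Φ x k * (A · g) (φ k) ≤ (A · x) (φ k) * (A · x) (φ k)
    Φ-bound Ag-pos x k = begin
      Φ x k * (A · g) i
        ≈⟨ *-congˡ {Φ x k} {(A · g) i} {⟨ Tg , N · Tg ⟩} inh-g ⟩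
      Φ x k * ⟨ Tg , N · Tg ⟩
        ≤⟨ hyperbolic-next (next v i) (next-edge v i) Tx Tg
             (<-≤-trans {0#} {(A · g) i} {⟨ Tg , N · Tg ⟩} (Ag-pos k)
               (≤-reflexive {(A · g) i} {⟨ Tg , N · Tg ⟩} inh-g)) ⟩
      ⟨ Tx , N · Tg ⟩ * ⟨ Tx , N · Tg ⟩
        ≈⟨ *-cong {(A · x) i} {⟨ Tx , N · Tg ⟩} {(A · x) i} {⟨ Tx , N · Tg ⟩} inh-x inh-x ⟨
      (A · x) i * (A · x) i ∎
      where
      open import Relation.Binary.Reasoning.PartialOrder poset
      i = φ k
      N = M (next v i)
      Tx = T v i x
      Tg = T v i g
      inh-g = inh v i (in-support k) g
      inh-x = inh v i (in-support k) x

    hyperbolic : (∀ k → 0# < (A · g) (φ k)) → HyperbolicMatrix A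
    hyperbolic Ag-pos = Restriction.hyperbolic A (M-symmetric (vertex v)) (M-nonNeg (vertex v)) g
      φ φ-injective A≈0-off-support (λ k → h-pos (φ k) (in-support k)) Ag-pos
      (irreducible⇒connected {A = restrict E} (irreducible E)) Φ (pull v E) (Φ-bound Ag-pos)
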